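{- Let $\mathcal{C}$ be a covering of a finite set $U$ with $|U|=m$, such that there are no two distinct elements $u,v\in U$ with $\mathcal{C}(\{u\})=\mathcal{C}(\{v\})$ and $|\mathcal{C}(\{u\})|=1$. Let $G$ be a finite group, $n\geq 0$ an integer, and $Q_n(G)$ the Dowling lattice. If $L(\mathcal{C})\cong Q_n(G)$, then either $n\in\{0,1\}$ or $n=2$. In the case $n=2$, we must have $m=|G|+2$ and $k=1$, where $k:=|\mathcal{E}|$.
   Context: A covering of a finite set $U$ is a collection $\mathcal{C}\subseteq 2^U$ of subsets of $U$ whose union is $U$. For $H\subseteq U$, $\mathcal{C}(H):=\{C\in\mathcal{C} : C\cap H\neq\emptyset\}$. The matroid $M(\mathcal{C})$ is the transversal matroid of $\mathcal{C}$ on the ground set $U$: its independent sets are the partial transversals of $\mathcal{C}$, i.e. the sets $I\subseteq U$ for which there is an injective map $\varphi:I\to\mathcal{C}$ with $e\in\varphi(e)$ for all $e\in I$. $L(\mathcal{C})$ is the lattice of closed sets (flats) of $M(\mathcal{C})$ ordered by inclusion. For $x\in U$ with $|\mathcal{C}(\{x\})|=2$, $E(\{x\}):=\{y\in U : \mathcal{C}(\{y\})\subseteq\mathcal{C}(\{x\})\}$, and $\mathcal{E}:=\{E(\{x\}) : x\in U,\ |\mathcal{C}(\{x\})|=2\}$. Dowling lattice $Q_n(G)$: let $N=\{1,\dots,n\}$. A partial $G$-partition of $N$ is data $(Z;(B_1,a_1),\dots,(B_t,a_t))$ where $Z\subseteq N$ (the zero block), $\{B_1,\dots,B_t\}$ is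 a partition of $N\setminus Z$ into nonempty blocks, and each $a_i:B_i\to G$ is a function. Two such data are identified if they have the same zero block and the same nonzero blocks, and on each nonzero block $B$ the two labelings $a,a'$ satisfy $a'(x)=g\,a(x)$ for all $x\in B$, for some $g\in G$ (depending on $B$). The elements of $Q_n(G)$ are the resulting equivalence classes. The order is: $[(Z;(B_1,a_1),\dots,(B_t,a_t))]\leq[(Z';(C_1,b_1),\dots,(C_r,b_r))]$ if $Z\subseteq Z'$, each $C_j$ is a union of blocks among $B_1,\dots,B_t$, and for every $B_i\subseteq C_j$ there is $g_i\in G$ with $b_j(x)=g_i\,a_i(x)$ for all $x\in B_i$. -}

module Defs where

import Data.Bool.Properties as Bool
open import Algebra.Bundles using (Group)
open import Data.Empty using (⊥-elim)
open import Data.Fin.Base using (Fin)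
open import Data.Fin.Subset
open import Data.Fin.Subset.Properties
  using (nonempty?; ∉⊥; x∈p∪q⁻; x∈p∪q⁺; ⊆-antisym; ⊆-reflexive; ⊆-trans)
open import Data.List.Base using (List; []; _∷_; map; filter; length; deduplicate; allFin; tabulate; concatMap)
import Data.List.Membership.Propositional as List
open import Data.List.Membership.Propositional.Properties
  using (∈-map⁺; ∈-map⁻; ∈-concatMap⁺; ∈-concatMap⁻)
import Data.List.Relation.Binary.Subset.DecPropositional as DecSubset
open import Data.List.Relation.Unary.Any using (here; there)
import Data.List.Relation.Unary.Any as Any
open import Data.List.Relation.Unary.Unique.Propositional using (Unique)
open import Data.Nat.Base using (ℕ; _≤_)
open import Data.Nat.Properties using (_≟_)
open import Data.Product.Base using (Σ; ∃; _×_; _,_; proj₁; proj₂)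
open import Data.Sum.Base using (inj₁; inj₂)
import Data.Vec.Base as Vec
import Data.Vec.Properties as Vec
open import Function.Base using (_on_)
open import Level using (Level; 0ℓ; _⊔_)
open import Relation.Binary.Bundles using (Poset)
open import Relation.Binary.Definitions using (DecidableEquality)
open import Relation.Binary.Morphism.Structures using (IsOrderIsomorphism)
open import Relation.Binary.PropositionalEquality.Core using (_≡_; refl; sym; trans; cong; subst)
open import Relation.Nullary.Decidable.Core using (does)

infix 4 _≅_

_≅_ : ∀ {a₁ a₂ a₃ b₁ b₂ b₃} → Poset a₁ a₂ a₃ → Poset b₁ b₂ b₃ → Set (a₁ ⊔ a₂ ⊔ a₃ ⊔ b₁ ⊔ b₂ ⊔ b₃)
P ≅ Q = ∃ λ f → IsOrderIsomorphism P._≈_ Q._≈_ P._≤_ Q._≤_ f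
  where
  module P = Poset P
  module Q = Poset Q

_≟ˢ_ : ∀ {m} → DecidableEquality (Subset m)
_≟ˢ_ = Vec.≡-dec Bool._≟_

-- The ground set U is Fin m.  A collection of subsets is a list without
-- repetitions, so the length of such a list is its cardinality.

record Covering (m : ℕ) : Set where
  field
    sets   : List (Subset m)
    unique : Unique sets
    covers : ⋃ sets ≡ ⊤

  meeting : Subset m → List (Subset m)
  meeting H = filter (λ C → nonempty? (C ∩ H)) sets

  E : Fin m → Subset m
  E x = Vec.tabulate λ y → does (meeting ⁅ y ⁆ ⊆? meeting ⁅ x ⁆)
    where open DecSubset _≟ˢ_ using (_⊆?_)

  -- Different x may give the same set E x; it is listed only once.
  ℰ : List (Subset m)
  ℰ = deduplicate _≟ˢ_ (map E (filter (λ x → length (meeting ⁅ x ⁆) ≟ 2) (allFin m)))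

  -- Only the values of φ on I matter: φ restricted to I is an injection
  -- into the covering.
  PartialTransversal : Subset m → Set
  PartialTransversal I = ∃ λ (φ : Fin m → Subset m) →
    (∀ {e} → e ∈ I → φ e List.∈ sets × e ∈ φ e) ×
    (∀ {e f} → e ∈ I → f ∈ I → φ e ≡ φ f → e ≡ f)

module Flats {m : ℕ} (Independent : Subset m → Set) where

  record HasRank (A : Subset m) (r : ℕ) : Set where
    field
      attained : ∃ λ I → Independent I × I ⊆ A × ∣ I ∣ ≡ r
      maximal  : ∀ {I} → Independent I → I ⊆ A → ∣ I ∣ ≤ r

  _∈Closure_ : Fin m → Subset m → Set
  x ∈Closure A = ∃ λ r → HasRank A r × HasRank (A ∪ ⁅ x ⁆) r

  IsFlat : Subset m → Set
  IsFlat F = ∀ {x} → x ∈Closure F → x ∈ F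

  flats : Poset 0ℓ 0ℓ 0ℓ
  flats = record
    { Carrier        = Σ (Subset m) IsFlat
    ; _≈_            = _≡_ on proj₁
    ; _≤_            = _⊆_ on proj₁
    ; isPartialOrder = record
      { isPreorder = record
        { isEquivalence = record { refl = refl ; sym = sym ; trans = trans }
        ; reflexive     = ⊆-reflexive
        ; trans         = ⊆-trans
        }
      ; antisym = ⊆-antisym
      }
    }

L : ∀ {m} → Covering m → Poset 0ℓ 0ℓ 0ℓ
L 𝒞 = Flats.flats (Covering.PartialTransversal 𝒞)

∈⋃⁺ : ∀ {n} {x : Fin n} {p} {ps : List (Subset n)} → p List.∈ ps → x ∈ p → x ∈ ⋃ ps
∈⋃⁺ (here refl) x∈p = x∈p∪q⁺ (inj₁ x∈p)
∈⋃⁺ (there p∈)  x∈p = x∈p∪q⁺ (inj₂ (∈⋃⁺ p∈ x∈p))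

∈⋃⁻ : ∀ {n} {x : Fin n} (ps : List (Subset n)) → x ∈ ⋃ ps → ∃ λ p → p List.∈ ps × x ∈ p
∈⋃⁻ []       x∈ = ⊥-elim (∉⊥ x∈)
∈⋃⁻ (p ∷ ps) x∈ with x∈p∪q⁻ p (⋃ ps) x∈
... | inj₁ x∈p = p , here refl , x∈p
... | inj₂ x∈⋃ with ∈⋃⁻ ps x∈⋃
...   | q , q∈ , x∈q = q , there q∈ , x∈q

∈-irrelevant : ∀ {n} {x : Fin n} {p : Subset n} (x∈p x∈p′ : x ∈ p) → x∈p ≡ x∈p′
∈-irrelevant Vec.here      Vec.here       = refl
∈-irrelevant (Vec.there q) (Vec.there q′) = cong Vec.there (∈-irrelevant q q′)

module _ {c ℓ : Level} (G : Group c ℓ) (n : ℕ) where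

  private module G = Group G

  record PartialGPartition : Set c where
    field
      zeroBlock : Subset n
      size      : ℕ
      block     : Fin size → Subset n
      nonempty  : ∀ i → Nonempty (block i)
      disjoint  : ∀ {i j x} → x ∈ block i → x ∈ block j → i ≡ j
      exhaust   : ⋃ (tabulate block) ≡ ∁ zeroBlock
      label     : ∀ i {x} → x ∈ block i → G.Carrier

  open PartialGPartition

  -- Used only when the i-th block of P is contained in the j-th block of Q,
  -- so x ranges over the whole i-th block of P.
  Translate : (P Q : PartialGPartition) → Fin (size P) → Fin (size Q) → Set (c ⊔ ℓ)
  Translate P Q i j = ∃ λ g → ∀ {x} (x∈Pᵢ : x ∈ block P i) (x∈Qⱼ : x ∈ block Q j) →
    label Q j x∈Qⱼ G.≈ g G.∙ label P i x∈Pᵢ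

  record _≈ᴰ_ (P Q : PartialGPartition) : Set (c ⊔ ℓ) where
    field
      zeroBlock≡ : zeroBlock P ≡ zeroBlock Q
      blocks⊆    : ∀ i → ∃ λ j → block P i ≡ block Q j
      blocks⊇    : ∀ j → ∃ λ i → block P i ≡ block Q j
      labels     : ∀ {i j} → block P i ≡ block Q j → Translate P Q i j

  record _≤ᴰ_ (P Q : PartialGPartition) : Set (c ⊔ ℓ) where
    field
      zeroBlock⊆ : zeroBlock P ⊆ zeroBlock Q
      unions     : ∀ j → ∃ λ (is : List (Fin (size P))) → block Q j ≡ ⋃ (map (block P) is)
      labels     : ∀ {i j} → block P i ⊆ block Q j → Translate P Q i j

  private
    open _≈ᴰ_
    open _≤ᴰ_ renaming (labels to labels≤)

    blockBelow : ∀ {P Q : PartialGPartition} → P ≤ᴰ Q → ∀ {j x} → x ∈ block Q j →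
              ∃ λ i → x ∈ block P i × block P i ⊆ block Q j
    blockBelow {P} P≤Q {j} x∈Qⱼ with unions P≤Q j
    ... | is , eq with ∈⋃⁻ (map (block P) is) (subst (_ ∈_) eq x∈Qⱼ)
    ...   | p , p∈ , x∈p with ∈-map⁻ (block P) p∈
    ...     | i , i∈ , refl = i , x∈p , λ y∈ → subst (_ ∈_) (sym eq) (∈⋃⁺ (∈-map⁺ (block P) i∈) y∈)

    ≡⇒index≡ : ∀ (P : PartialGPartition) {i j} → block P i ≡ block P j → i ≡ j
    ≡⇒index≡ P {i} eq with nonempty P i
    ... | x , x∈ = disjoint P x∈ (subst (x ∈_) eq x∈)

    label-cong : ∀ (P : PartialGPartition) i {x} (p q : x ∈ block P i) → label P i p G.≈ label P i q
    label-cong P i p q = G.reflexive (cong (label P i) (∈-irrelevant p q))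

    translate-refl : ∀ (P : PartialGPartition) i → Translate P P i i
    translate-refl P i = G.ε , λ p q → G.trans (label-cong P i q p) (G.sym (G.identityˡ _))

    translate-sym : ∀ (P Q : PartialGPartition) {i j} → Translate P Q i j → Translate Q P j i
    translate-sym P Q (g , eq) = g G.⁻¹ , λ q p → G.sym
      (G.trans (G.∙-congˡ (eq p q)) (G.trans (G.sym (G.assoc _ _ _))
      (G.trans (G.∙-congʳ (G.inverseˡ g)) (G.identityˡ _))))

    translate-trans : ∀ (P Q R : PartialGPartition) {i j k} → block P i ⊆ block Q j →
                      Translate P Q i j → Translate Q R j k → Translate P R i k
    translate-trans P Q R Pᵢ⊆Qⱼ (g , eq) (h , eq′) = h G.∙ g , λ p r →
      G.trans (eq′ (Pᵢ⊆Qⱼ p) r) (G.trans (G.∙-congˡ (eq p (Pᵢ⊆Qⱼ p))) (G.sym (G.assoc _ _ _)))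

    ≈-refl : ∀ {P : PartialGPartition} → P ≈ᴰ P
    ≈-refl {P} = record
      { zeroBlock≡ = refl
      ; blocks⊆    = λ i → i , refl
      ; blocks⊇    = λ i → i , refl
      ; labels     = λ {i} eq → subst (Translate P P i) (≡⇒index≡ P eq) (translate-refl P i)
      }

    ≈-sym : ∀ {P Q : PartialGPartition} → P ≈ᴰ Q → Q ≈ᴰ P
    ≈-sym {P} {Q} e = record
      { zeroBlock≡ = sym (zeroBlock≡ e)
      ; blocks⊆    = λ j → let i , eq = blocks⊇ e j in i , sym eq
      ; blocks⊇    = λ i → let j , eq = blocks⊆ e i in j , sym eq
      ; labels     = λ eq → translate-sym P Q (labels e (sym eq))
      }

    ≈-trans : ∀ {P Q R : PartialGPartition} → P ≈ᴰ Q → Q ≈ᴰ R → P ≈ᴰ R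
    ≈-trans {P} {Q} {R} e f = record
      { zeroBlock≡ = trans (zeroBlock≡ e) (zeroBlock≡ f)
      ; blocks⊆    = λ i → let j , eq = blocks⊆ e i ; k , eq′ = blocks⊆ f j in k , trans eq eq′
      ; blocks⊇    = λ k → let j , eq = blocks⊇ f k ; i , eq′ = blocks⊇ e j in i , trans eq′ eq
      ; labels     = λ {i} {k} eq → let j , eq′ = blocks⊆ e i in
          translate-trans P Q R (⊆-reflexive eq′) (labels e eq′) (labels f (trans (sym eq′) eq))
      }

    ≤-reflexive : ∀ {P Q : PartialGPartition} → P ≈ᴰ Q → P ≤ᴰ Q
    ≤-reflexive {P} {Q} e = record
      { zeroBlock⊆ = ⊆-reflexive (zeroBlock≡ e)
      ; unions     = λ j → let i , eq = blocks⊇ e j in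
          i ∷ [] , trans (sym eq) (⊆-antisym (∈⋃⁺ {ps = block P i ∷ []} (here refl)) (single i))
      ; labels     = λ {i} {j} Pᵢ⊆Qⱼ → labels e (same Pᵢ⊆Qⱼ)
      }
      where
      single : ∀ i → ⋃ (block P i ∷ []) ⊆ block P i
      single i x∈ with ∈⋃⁻ (block P i ∷ []) x∈
      ... | _ , here refl , x∈p = x∈p

      same : ∀ {i j} → block P i ⊆ block Q j → block P i ≡ block Q j
      same {i} {j} Pᵢ⊆Qⱼ with blocks⊆ e i | nonempty P i
      ... | k , eq | x , x∈ = trans eq (cong (block Q) (disjoint Q (subst (x ∈_) eq x∈) (Pᵢ⊆Qⱼ x∈)))

    ≤-trans : ∀ {P Q R : PartialGPartition} → P ≤ᴰ Q → Q ≤ᴰ R → P ≤ᴰ R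
    ≤-trans {P} {Q} {R} P≤Q Q≤R = record
      { zeroBlock⊆ = ⊆-trans (zeroBlock⊆ P≤Q) (zeroBlock⊆ Q≤R)
      ; unions     = λ k → let js , eq = unions Q≤R k in
          concatMap parts js , trans eq (⊆-antisym (to js) (from js))
      ; labels     = composite
      }
      where
      parts : Fin (size Q) → List (Fin (size P))
      parts j = proj₁ (unions P≤Q j)

      to : ∀ js → ⋃ (map (block Q) js) ⊆ ⋃ (map (block P) (concatMap parts js))
      to js x∈ with ∈⋃⁻ (map (block Q) js) x∈
      ... | _ , q∈ , x∈q with ∈-map⁻ (block Q) q∈
      ...   | j , j∈ , refl with ∈⋃⁻ (map (block P) (parts j)) (subst (_ ∈_) (proj₂ (unions P≤Q j)) x∈q)
      ...     | _ , p∈ , x∈p with ∈-map⁻ (block P) p∈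
      ...       | i , i∈ , refl =
        ∈⋃⁺ (∈-map⁺ (block P) (∈-concatMap⁺ parts (Any.map (λ { refl → i∈ }) j∈))) x∈p

      from : ∀ js → ⋃ (map (block P) (concatMap parts js)) ⊆ ⋃ (map (block Q) js)
      from js x∈ with ∈⋃⁻ (map (block P) (concatMap parts js)) x∈
      ... | _ , p∈ , x∈p with ∈-map⁻ (block P) p∈
      ...   | i , i∈ , refl with List.find (∈-concatMap⁻ parts {xs = js} i∈)
      ...     | j , j∈ , i∈j = ∈⋃⁺ (∈-map⁺ (block Q) j∈)
        (subst (_ ∈_) (sym (proj₂ (unions P≤Q j))) (∈⋃⁺ (∈-map⁺ (block P) i∈j) x∈p))

      composite : ∀ {i k} → block P i ⊆ block R k → Translate P R i k
      composite {i} Pᵢ⊆Rₖ with nonempty P i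
      ... | x , x∈Pᵢ with blockBelow Q≤R (Pᵢ⊆Rₖ x∈Pᵢ)
      ...   | j , x∈Qⱼ , Qⱼ⊆Rₖ with blockBelow P≤Q x∈Qⱼ
      ...     | i′ , x∈Pᵢ′ , Pᵢ′⊆Qⱼ with disjoint P x∈Pᵢ x∈Pᵢ′
      ...       | refl = translate-trans P Q R Pᵢ′⊆Qⱼ (labels≤ P≤Q Pᵢ′⊆Qⱼ) (labels≤ Q≤R Qⱼ⊆Rₖ)

    matching : ∀ {P Q : PartialGPartition} → P ≤ᴰ Q → Q ≤ᴰ P → ∀ i → ∃ λ j → block P i ≡ block Q j
    matching {P} P≤Q Q≤P i with nonempty P i
    ... | x , x∈Pᵢ with blockBelow Q≤P x∈Pᵢ
    ...   | j , x∈Qⱼ , Qⱼ⊆Pᵢ with blockBelow P≤Q x∈Qⱼ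
    ...     | i′ , x∈Pᵢ′ , Pᵢ′⊆Qⱼ with disjoint P x∈Pᵢ x∈Pᵢ′
    ...       | refl = j , ⊆-antisym Pᵢ′⊆Qⱼ Qⱼ⊆Pᵢ

    ≤-antisym : ∀ {P Q : PartialGPartition} → P ≤ᴰ Q → Q ≤ᴰ P → P ≈ᴰ Q
    ≤-antisym P≤Q Q≤P = record
      { zeroBlock≡ = ⊆-antisym (zeroBlock⊆ P≤Q) (zeroBlock⊆ Q≤P)
      ; blocks⊆    = matching P≤Q Q≤P
      ; blocks⊇    = λ j → let i , eq = matching Q≤P P≤Q j in i , sym eq
      ; labels     = λ eq → labels≤ P≤Q (⊆-reflexive eq)
      }

  DowlingLattice : Poset c (c ⊔ ℓ) (c ⊔ ℓ)
  DowlingLattice = record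
    { Carrier        = PartialGPartition
    ; _≈_            = _≈ᴰ_
    ; _≤_            = _≤ᴰ_
    ; isPartialOrder = record
      { isPreorder = record
        { isEquivalence = record { refl = ≈-refl ; sym = ≈-sym ; trans = ≈-trans }
        ; reflexive     = ≤-reflexive
        ; trans         = ≤-trans
        }
      ; antisym = ≤-antisym
      }
    }

{-# OPTIONS --safe #-}

module Submission where

open import Algebra.Bundles using (Group)
import Algebra.Properties.Group as GroupProperties
open import Data.Bool.Base using (if_then_else_)
open import Data.Empty using (⊥-elim)
import Data.Empty as Empty
open import Data.Fin.Base using (Fin; zero; suc; punchIn; punchOut; join; splitAt)
open import Data.Fin.Properties
  using (_≟_; injective⇒≤; punchIn-punchOut; punchOut-injective; splitAt-join; join-splitAt)
import Data.Fin.Properties as Fin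
open import Data.Fin.Subset
open import Data.Fin.Subset.Properties
open import Data.List.Base using (List; []; _∷_; length; map; filter; allFin; tabulate)
open import Data.List.Membership.Propositional using (find; lose) renaming (_∈_ to _∈ₗ_)
open import Data.List.Membership.Propositional.Properties using
  (∈-filter⁺; ∈-filter⁻; ∈-map⁺; ∈-map⁻; ∈-tabulate⁺; ∈-tabulate⁻; ∈-allFin; ∈-deduplicate⁺; ∈-deduplicate⁻)
open import Data.List.Membership.Propositional.Properties.WithK using (unique∧set⇒bag)
open import Data.List.Relation.Binary.BagAndSetEquality using (_∼[_]_; set; ∼bag⇒↭)
open import Data.List.Relation.Binary.Permutation.Propositional.Properties using (↭-length)
import Data.List.Relation.Binary.Subset.DecPropositional as DecSubset
open import Data.List.Relation.Unary.All using (All; []; _∷_)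
import Data.List.Relation.Unary.All as All
open import Data.List.Relation.Unary.AllPairs using (AllPairs; []; _∷_)
open import Data.List.Relation.Unary.Any using (here; there; any?)
open import Data.List.Relation.Unary.Unique.DecPropositional.Properties using (deduplicate-!)
open import Data.List.Relation.Unary.Unique.Propositional using (Unique)
open import Data.List.Relation.Unary.Unique.Propositional.Properties using (filter⁺)
open import Data.Maybe.Base using (Maybe; just; nothing)
import Data.Maybe.Properties as Maybe
open import Data.Nat.Base using (ℕ; suc; z≤n; s≤s; s≤s⁻¹; _+_; _≤_; _<_)
open import Data.Nat.Properties
  using (≤-trans; ≤-refl; ≤-reflexive; ≤-antisym; +-suc; +-mono-≤; +-monoʳ-≤; <⇒≱; ≰⇒>; 1+n≰n)
  renaming (_≟_ to _≟ℕ_)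
open import Data.Product.Base using (Σ; ∃; ∃₂; _×_; _,_; proj₁; proj₂)
open import Data.Sum.Base using (_⊎_; inj₁; inj₂; [_,_]′)
import Data.Sum.Base as Sum
import Data.Vec.Base as Vec
open import Data.Vec.Functional using (insertAt)
open import Data.Vec.Functional.Properties using (insertAt-lookup; insertAt-punchIn)
open import Data.Vec.Properties using (lookup∘tabulate; []=⇒lookup; lookup⇒[]=)
open import Function.Base using (_∘_; id; const)
open import Function.Bundles using (Inverse; mk⇔)
open import Function.Definitions using (Injective)
open import Level using (Level)
open import Relation.Binary.Bundles using (Poset)
open import Relation.Binary.Morphism.Structures using (IsOrderIsomorphism)
open import Relation.Binary.PropositionalEquality using (_≡_; _≢_; refl; sym; trans; cong; subst; setoid)
open import Relation.Nullary using (¬_; Dec; does; yes; no; ¬?; contradiction; _×-dec_; _⊎-dec_)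
open import Relation.Nullary.Decidable using (decidable-stable; dec-true)
open import Relation.Unary using (Pred; Decidable)
open import Defs

-- Write N(x) for the sets of 𝒞 containing x; by hypothesis M(𝒞) is simple.  If some
-- x ≠ y span a third point z then N(x) ∪ N(y) ∪ N(z) consists of two sets P and Q, since
-- otherwise {x, y} is itself a flat.  At most one point of the line lies in P only and at
-- most one in Q only, so one of x, y, z lies in both; every longer line through that
-- point then also has its points covered by P and Q, hence is the same line.  In Q_n(G)
-- with n ≥ 3 the atoms e₀₁, e₀₂, e₁₂ are collinear and each e_ij lies on a second line,
-- with the zero-block atoms of i and j, which is a contradiction.  For n = 2 the ground
-- set is one such line and its points are the |G| + 2 atoms of Q_2(G).

-- Finite subsets and lists without repetition

module _ {n p} {P : Pred (Fin n) p} (P? : Decidable P) where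

  ∈-separate⁺ : ∀ {x} → P x → x ∈ Vec.tabulate (does ∘ P?)
  ∈-separate⁺ {x} px = lookup⇒[]= x _ (trans (lookup∘tabulate _ x) (dec-true (P? x) px))

  ∈-separate⁻ : ∀ {x} → x ∈ Vec.tabulate (does ∘ P?) → P x
  ∈-separate⁻ {x} x∈ with P? x | trans (sym (lookup∘tabulate (does ∘ P?) x)) ([]=⇒lookup x∈)
  ... | yes px | _ = px

∣p∪q∣≤∣p∣+∣q∣ : ∀ {n} (p q : Subset n) → ∣ p ∪ q ∣ ≤ ∣ p ∣ + ∣ q ∣
∣p∪q∣≤∣p∣+∣q∣ Vec.[] Vec.[] = z≤n
∣p∪q∣≤∣p∣+∣q∣ (outside Vec.∷ p) (outside Vec.∷ q) = ∣p∪q∣≤∣p∣+∣q∣ p q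
∣p∪q∣≤∣p∣+∣q∣ (outside Vec.∷ p) (inside Vec.∷ q) =
  subst (suc ∣ p ∪ q ∣ ≤_) (sym (+-suc ∣ p ∣ ∣ q ∣)) (s≤s (∣p∪q∣≤∣p∣+∣q∣ p q))
∣p∪q∣≤∣p∣+∣q∣ (inside Vec.∷ p) (s Vec.∷ q) =
  s≤s (≤-trans (∣p∪q∣≤∣p∣+∣q∣ p q) (+-monoʳ-≤ ∣ p ∣ (∣p∣≤∣x∷p∣ s q)))

module _ {a} {A : Set a} where

  unique-length : ∀ {xs ys : List A} → Unique xs → Unique ys →
                  (∀ {z} → z ∈ₗ xs → z ∈ₗ ys) → (∀ {z} → z ∈ₗ ys → z ∈ₗ xs) → length xs ≡ length ys
  unique-length xs! ys! xs⊆ys ys⊆xs =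
    ↭-length (∼bag⇒↭ (unique∧set⇒bag xs! ys! (mk⇔ xs⊆ys ys⊆xs)))

  -- Two distinct entries, each `P` or `Q`, must be `P` and `Q` in some order.
  length≡2⇒both : ∀ {xs : List A} {P Q} → Unique xs → length xs ≡ 2 →
                  (∀ {z} → z ∈ₗ xs → z ≡ P ⊎ z ≡ Q) → P ∈ₗ xs × Q ∈ₗ xs
  length≡2⇒both {_ ∷ _ ∷ []} ((x≢y ∷ []) ∷ _) refl only with only (here refl) | only (there (here refl))
  ... | inj₁ refl | inj₁ refl = contradiction refl x≢y
  ... | inj₁ refl | inj₂ refl = here refl , there (here refl)
  ... | inj₂ refl | inj₁ refl = there (here refl) , here refl
  ... | inj₂ refl | inj₂ refl = contradiction refl x≢y

-- Lines in transversal matroids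

module TransversalMatroid {m : ℕ} (𝒞 : Covering m) where

  open Covering 𝒞
  open Flats PartialTransversal

  Flat : Set
  Flat = Σ (Subset m) IsFlat

  ∈-meeting⁺ : ∀ {x C} → C ∈ₗ sets → x ∈ C → C ∈ₗ meeting ⁅ x ⁆
  ∈-meeting⁺ {x} C∈ x∈C = ∈-filter⁺ _ C∈ (x , x∈p∩q⁺ (x∈C , x∈⁅x⁆ x))

  ∈-meeting⁻ : ∀ {x C} → C ∈ₗ meeting ⁅ x ⁆ → C ∈ₗ sets × x ∈ C
  ∈-meeting⁻ {x} {C} C∈ with ∈-filter⁻ _ {xs = sets} C∈
  ... | C∈sets , y , y∈ with x∈p∩q⁻ C ⁅ x ⁆ y∈
  ...   | y∈C , y∈x = C∈sets , subst (_∈ C) (x∈⁅y⁆⇒x≡y x y∈x) y∈C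

  meeting-unique : ∀ H → Unique (meeting H)
  meeting-unique H = filter⁺ (λ C → nonempty? (C ∩ H)) unique

  covering-set : ∀ x → ∃ λ C → C ∈ₗ sets × x ∈ C
  covering-set x = ∈⋃⁻ sets (subst (x ∈_) (sym covers) ∈⊤)

  -- A system of distinct representatives, given by its graph.
  SDR : List (Fin m × Subset m) → Set
  SDR ps = AllPairs (λ (e , C) (f , D) → e ≢ f × C ≢ D) ps × All (λ (e , C) → C ∈ₗ sets × e ∈ C) ps

  support : List (Fin m × Subset m) → Subset m
  support ps = ⋃ (map (⁅_⁆ ∘ proj₁) ps)

  select : List (Fin m × Subset m) → Fin m → Subset m
  -- The default is immaterial: a partial transversal constrains its map only on the support.
  select []             e = ⊥
  select ((f , C) ∷ ps) e = if does (e ≟ f) then C else select ps e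

  select-∈ : ∀ ps {e} → e ∈ support ps → (e , select ps e) ∈ₗ ps
  select-∈ []             e∈ = contradiction e∈ ∉⊥
  select-∈ ((f , C) ∷ ps) {e} e∈ with e ≟ f
  ... | yes refl = here refl
  ... | no  e≢f with x∈p∪q⁻ ⁅ f ⁆ (support ps) e∈
  ...   | inj₁ e∈f = contradiction (x∈⁅y⁆⇒x≡y f e∈f) e≢f
  ...   | inj₂ e∈  = there (select-∈ ps e∈)

  support⊆ : ∀ {ps A} → All (λ (e , _) → e ∈ A) ps → support ps ⊆ A
  support⊆ all e∈ = All.lookup all (select-∈ _ e∈)

  SDR⇒independent : ∀ {ps} → SDR ps → PartialTransversal (support ps)
  SDR⇒independent {ps} (distinct , valid) =
    select ps , All.lookup valid ∘ select-∈ ps ,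
    λ e∈ f∈ → injective distinct (select-∈ ps e∈) (select-∈ ps f∈)
    where
    injective : ∀ {qs e f C D} → AllPairs (λ (e , C) (f , D) → e ≢ f × C ≢ D) qs →
                (e , C) ∈ₗ qs → (f , D) ∈ₗ qs → C ≡ D → e ≡ f
    injective _        (here refl) (here refl) _   = refl
    injective (d ∷ _)  (here refl) (there q)   C≡D = contradiction C≡D (proj₂ (All.lookup d q))
    injective (d ∷ _)  (there p)   (here refl) C≡D = contradiction (sym C≡D) (proj₂ (All.lookup d p))
    injective (_ ∷ ds) (there p)   (there q)   C≡D = injective ds p q C≡D

  -- Each pair contributes an element outside the support of the pairs after it.
  SDR⇒length≤ : ∀ {ps} → SDR ps → length ps ≤ ∣ support ps ∣
  SDR⇒length≤ {[]}           _ = z≤n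
  SDR⇒length≤ {(e , _) ∷ ps} (d ∷ ds , _ ∷ vs) =
    ≤-trans (s≤s (SDR⇒length≤ (ds , vs)))
      (p⊂q⇒∣p∣<∣q∣ (q⊆p∪q ⁅ e ⁆ (support ps) , e , p⊆p∪q (support ps) (x∈⁅x⁆ e) ,
        λ e∈ → proj₁ (All.lookup d (select-∈ ps e∈)) refl))

  -- Rank criterion for flats. If `w` were in the closure of `F`, then `F` and `F ∪ ⁅ w ⁆` would
  -- share a rank; the first bound makes it at most `r`, while the representatives found in
  -- `F ∪ ⁅ w ⁆` make it exceed `r`.
  isFlat : ∀ {F} r → (∀ {I} → PartialTransversal I → I ⊆ F → ∣ I ∣ ≤ r) →
           (∀ {w} → w ∉ F → ∃ λ ps → SDR ps × All (λ (e , _) → e ∈ F ∪ ⁅ w ⁆) ps × r < length ps) →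
           IsFlat F
  isFlat {F} r bound larger {w} (s , rankF , rankF∪w) with w ∈? F
  ... | yes w∈F = w∈F
  ... | no  w∉F with larger w∉F | HasRank.attained rankF
  ...   | ps , sdr , ps⊆ , r< | I , indep , I⊆F , refl =
    contradiction
      (≤-trans (SDR⇒length≤ sdr) (HasRank.maximal rankF∪w (SDR⇒independent sdr) (support⊆ {ps} ps⊆)))
      (<⇒≱ (≤-trans (s≤s (bound indep I⊆F)) r<))

  CoveredBy : Subset m → Subset m → Fin m → Set
  CoveredBy P Q z = ∀ {C} → C ∈ₗ sets → z ∈ C → C ≡ P ⊎ C ≡ Q

  coveredOrEscapes : ∀ P Q z → CoveredBy P Q z ⊎ ∃ λ C → C ∈ₗ sets × z ∈ C × C ≢ P × C ≢ Q
  coveredOrEscapes P Q z with any? (λ C → (z ∈? C) ×-dec (¬? (C ≟ˢ P) ×-dec ¬? (C ≟ˢ Q))) sets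
  ... | yes esc = inj₂ (find esc)
  ... | no ¬esc = inj₁ λ {C} C∈ z∈C → decidable-stable ((C ≟ˢ P) ⊎-dec (C ≟ˢ Q))
    λ neither → ¬esc (lose C∈ (z∈C , neither ∘ inj₁ , neither ∘ inj₂))

  coveredBy? : ∀ P Q → Decidable (CoveredBy P Q)
  coveredBy? P Q z with coveredOrEscapes P Q z
  ... | inj₁ cov = yes cov
  ... | inj₂ (C , C∈ , z∈C , C≢P , C≢Q) = no λ cov → [ C≢P , C≢Q ]′ (cov C∈ z∈C)

  -- The closure of any two non-parallel elements covered by P and Q only.
  span : Subset m → Subset m → Subset m
  span P Q = Vec.tabulate (does ∘ coveredBy? P Q)

  ∈-span⁺ : ∀ {P Q x} → CoveredBy P Q x → x ∈ span P Q
  ∈-span⁺ {P} {Q} = ∈-separate⁺ (coveredBy? P Q)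

  ∈-span⁻ : ∀ {P Q x} → x ∈ span P Q → CoveredBy P Q x
  ∈-span⁻ {P} {Q} = ∈-separate⁻ (coveredBy? P Q)

  -- A representing map sends `I` into the two sets `P` and `Q`, and injectivity leaves at most one
  -- element in each fibre.
  span-bound : ∀ {P Q I} → PartialTransversal I → I ⊆ span P Q → ∣ I ∣ ≤ 2
  span-bound {P} {Q} {I} (φ , valid , injective) I⊆ =
    ≤-trans (p⊆q⇒∣p∣≤∣q∣ I⊆S∪T) (≤-trans (∣p∪q∣≤∣p∣+∣q∣ (proj₁ (fibre P)) (proj₁ (fibre Q)))
      (+-mono-≤ (proj₁ (proj₂ (fibre P))) (proj₁ (proj₂ (fibre Q)))))
    where
    fibre : ∀ R → ∃ λ S → ∣ S ∣ ≤ 1 × (∀ {e} → e ∈ I → φ e ≡ R → e ∈ S)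
    fibre R with Fin.any? (λ e → (e ∈? I) ×-dec (φ e ≟ˢ R))
    ... | yes (f , f∈ , φf≡R) = ⁅ f ⁆ , ≤-reflexive (∣⁅x⁆∣≡1 f) ,
      λ e∈ φe≡R → subst (_∈ ⁅ f ⁆) (injective f∈ e∈ (trans φf≡R (sym φe≡R))) (x∈⁅x⁆ f)
    ... | no none = ⊥ , subst (_≤ 1) (sym (∣⊥∣≡0 m)) z≤n , λ e∈ φe≡R → contradiction (_ , e∈ , φe≡R) none

    I⊆S∪T : I ⊆ proj₁ (fibre P) ∪ proj₁ (fibre Q)
    I⊆S∪T e∈ with ∈-span⁻ (I⊆ e∈) (proj₁ (valid e∈)) (proj₂ (valid e∈))
    ... | inj₁ φe≡P = x∈p∪q⁺ (inj₁ (proj₂ (proj₂ (fibre P)) e∈ φe≡P))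
    ... | inj₂ φe≡Q = x∈p∪q⁺ (inj₂ (proj₂ (proj₂ (fibre Q)) e∈ φe≡Q))

  -- An element outside the span lies in a set other than `P` and `Q`, which extends the two
  -- representatives to three.
  span-flat : ∀ {x y P Q} → SDR ((x , P) ∷ (y , Q) ∷ []) → x ∈ span P Q → y ∈ span P Q → IsFlat (span P Q)
  span-flat {x} {y} {P} {Q} (((x≢y , P≢Q) ∷ []) ∷ _ , vx ∷ vy ∷ []) x∈ y∈ =
    isFlat 2 (span-bound {P} {Q}) larger
    where
    larger : ∀ {w} → w ∉ span P Q →
             ∃ λ ps → SDR ps × All (λ (e , _) → e ∈ span P Q ∪ ⁅ w ⁆) ps × 2 < length ps
    larger {w} w∉ with coveredOrEscapes P Q w
    ... | inj₁ cov = contradiction (∈-span⁺ cov) w∉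
    ... | inj₂ (C , C∈ , w∈C , C≢P , C≢Q) =
      ((x , P) ∷ (y , Q) ∷ (w , C) ∷ []) ,
      (((x≢y , P≢Q) ∷ ((λ { refl → w∉ x∈ }) , C≢P ∘ sym) ∷ []) ∷
        (((λ { refl → w∉ y∈ }) , C≢Q ∘ sym) ∷ []) ∷ [] ∷ []
        , vx ∷ vy ∷ (C∈ , w∈C) ∷ []) ,
      p⊆p∪q _ x∈ ∷ p⊆p∪q _ y∈ ∷ q⊆p∪q _ _ (x∈⁅x⁆ w) ∷ [] ,
      ≤-refl

  -- Inside the span, `x` and `y` already attain the maximal rank 2, so adding `w` to `F` leaves its
  -- rank unchanged and closedness captures `w`.
  span-minimal : ∀ {x y P Q F} → SDR ((x , P) ∷ (y , Q) ∷ []) → IsFlat F →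
                 x ∈ F → y ∈ F → F ⊆ span P Q → span P Q ⊆ F
  span-minimal {x} {y} {P} {Q} {F} sdr flat x∈ y∈ F⊆ {w} w∈ =
    flat (2 , rank2 x∈ y∈ F⊆ , rank2 (p⊆p∪q _ x∈) (p⊆p∪q _ y∈) F∪w⊆)
    where
    ps : List (Fin m × Subset m)
    ps = (x , P) ∷ (y , Q) ∷ []

    rank2 : ∀ {A} → x ∈ A → y ∈ A → A ⊆ span P Q → HasRank A 2
    rank2 {A} x∈A y∈A A⊆ = record
      { attained = support ps , SDR⇒independent sdr , ⊆A ,
          ≤-antisym (span-bound {P} {Q} (SDR⇒independent sdr) (A⊆ ∘ ⊆A)) (SDR⇒length≤ sdr)
      ; maximal = λ indep I⊆A → span-bound {P} {Q} indep (A⊆ ∘ I⊆A)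
      }
      where
      ⊆A : support ps ⊆ A
      ⊆A = support⊆ {ps} (x∈A ∷ y∈A ∷ [])

    F∪w⊆ : F ∪ ⁅ w ⁆ ⊆ span P Q
    F∪w⊆ e∈ with x∈p∪q⁻ F ⁅ w ⁆ e∈
    ... | inj₁ e∈F = F⊆ e∈F
    ... | inj₂ e∈w = subst (_∈ span P Q) (sym (x∈⁅y⁆⇒x≡y w e∈w)) w∈

  ⊤-flat : IsFlat ⊤
  ⊤-flat _ = ∈⊤

  abstract
    ∅-flat : IsFlat ⊥
    ∅-flat = isFlat 0 (λ _ I⊆⊥ → ≤-trans (p⊆q⇒∣p∣≤∣q∣ I⊆⊥) (≤-reflexive (∣⊥∣≡0 m))) λ {w} _ →
      let C , C∈ , w∈C = covering-set w in
      (w , C) ∷ [] , ([] ∷ [] , (C∈ , w∈C) ∷ []) , q⊆p∪q _ _ (x∈⁅x⁆ w) ∷ [] , ≤-refl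

  -- By Hall's theorem, two elements are parallel exactly when both lie in the same single set; a
  -- covering has no loops, so excluding such pairs says that the matroid is simple.
  IsSimple : Set
  IsSimple = ∀ {u v : Fin m} → u ≢ v →
    ¬ (meeting ⁅ u ⁆ ∼[ set ] meeting ⁅ v ⁆ × length (meeting ⁅ u ⁆) ≡ 1)

  module Simple (simple : IsSimple) where

    -- Give `P` to `x` and any other set to `y`. If `y` lies in `P` only, give `P` to `y` and
    -- another set to `x`; if that fails too, both lie in `P` only, against simplicity.
    pair-SDR : ∀ {x y} → x ≢ y → ∃₂ λ P Q → SDR ((x , P) ∷ (y , Q) ∷ [])
    pair-SDR {x} {y} x≢y with covering-set x | covering-set y
    ... | P , P∈ , x∈P | R , R∈ , y∈R with any? (λ C → (y ∈? C) ×-dec ¬? (C ≟ˢ P)) sets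
    ...   | yes esc = let C , C∈ , y∈C , C≢P = find esc in
      P , C , (((x≢y , C≢P ∘ sym) ∷ []) ∷ [] ∷ [] , (P∈ , x∈P) ∷ (C∈ , y∈C) ∷ [])
    ...   | no ¬escʸ with any? (λ C → (x ∈? C) ×-dec ¬? (C ≟ˢ P)) sets
    ...     | yes esc = let C , C∈ , x∈C , C≢P = find esc in
      C , P , (((x≢y , C≢P) ∷ []) ∷ [] ∷ [] , (C∈ , x∈C) ∷ (P∈ , y∈P) ∷ [])
      where
      y∈P : y ∈ P
      y∈P = subst (y ∈_) (decidable-stable (R ≟ˢ P) λ R≢P → ¬escʸ (lose R∈ (y∈R , R≢P))) y∈R
    ...     | no ¬escˣ = ⊥-elim (simple x≢y
      ( mk⇔ (λ C∈ → subst (_∈ₗ _) (sym (onlyˣ C∈)) P∈y) (λ C∈ → subst (_∈ₗ _) (sym (onlyʸ C∈)) P∈x)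
      , unique-length (meeting-unique ⁅ x ⁆) ([] ∷ []) (λ C∈ → here (onlyˣ C∈)) (λ { (here refl) → P∈x })))
      where
      onlyˣ : ∀ {C} → C ∈ₗ meeting ⁅ x ⁆ → C ≡ P
      onlyˣ {C} C∈ = decidable-stable (C ≟ˢ P) λ C≢P →
        ¬escˣ (lose (proj₁ (∈-meeting⁻ C∈)) (proj₂ (∈-meeting⁻ C∈) , C≢P))

      onlyʸ : ∀ {C} → C ∈ₗ meeting ⁅ y ⁆ → C ≡ P
      onlyʸ {C} C∈ = decidable-stable (C ≟ˢ P) λ C≢P →
        ¬escʸ (lose (proj₁ (∈-meeting⁻ C∈)) (proj₂ (∈-meeting⁻ C∈) , C≢P))

      P∈x : P ∈ₗ meeting ⁅ x ⁆
      P∈x = ∈-meeting⁺ P∈ x∈P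

      P∈y : P ∈ₗ meeting ⁅ y ⁆
      P∈y = subst (_∈ₗ meeting ⁅ y ⁆) (onlyʸ (∈-meeting⁺ R∈ y∈R)) (∈-meeting⁺ R∈ y∈R)

    abstract
      ⁅⁆-flat : ∀ x → IsFlat ⁅ x ⁆
      ⁅⁆-flat x = isFlat 1 (λ _ I⊆ → ≤-trans (p⊆q⇒∣p∣≤∣q∣ I⊆) (≤-reflexive (∣⁅x⁆∣≡1 x))) λ {w} w∉ →
        let P , Q , sdr = pair-SDR {x} {w} λ { refl → w∉ (x∈⁅x⁆ x) } in
        (x , P) ∷ (w , Q) ∷ [] , sdr , p⊆p∪q _ (x∈⁅x⁆ x) ∷ q⊆p∪q _ _ (x∈⁅x⁆ w) ∷ [] , ≤-refl

    -- Both elements lie in `P` only, so distinct ones would be parallel: `pair-SDR` would have to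
    -- represent both by `P`.
    avoid-injective : ∀ {P Q x z} → CoveredBy P Q x → CoveredBy P Q z → x ∉ Q → z ∉ Q → x ≡ z
    avoid-injective {P} {Q} {x} {z} covx covz x∉Q z∉Q = decidable-stable (x ≟ z) λ x≢z → clash (proj₂ (proj₂ (pair-SDR x≢z)))
      where
      isP : ∀ {u A} → CoveredBy P Q u → u ∉ Q → A ∈ₗ sets → u ∈ A → A ≡ P
      isP cov u∉Q A∈ u∈A with cov A∈ u∈A
      ... | inj₁ A≡P  = A≡P
      ... | inj₂ refl = contradiction u∈A u∉Q

      clash : ∀ {A B} → ¬ SDR ((x , A) ∷ (z , B) ∷ [])
      clash (((_ , A≢B) ∷ []) ∷ _ , (A∈ , x∈A) ∷ (B∈ , z∈B) ∷ []) =
        A≢B (trans (isP covx x∉Q A∈ x∈A) (sym (isP covz z∉Q B∈ z∈B)))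

    coveredBy-swap : ∀ {P Q x} → CoveredBy P Q x → CoveredBy Q P x
    coveredBy-swap cov C∈ x∈C = Sum.swap (cov C∈ x∈C)

    covered-∈ : ∀ {P Q x} → CoveredBy P Q x → x ∉ P → x ∈ Q
    covered-∈ {x = x} cov x∉P with covering-set x
    ... | C , C∈ , x∈C with cov C∈ x∈C
    ...   | inj₁ refl = contradiction x∈C x∉P
    ...   | inj₂ refl = x∈C

    -- Since `t` lies in the distinct sets `P` and `Q` and in nothing besides `P′` and `Q′`, the two
    -- pairs of sets coincide up to order.
    transfer : ∀ {x y t u P Q P′ Q′} → SDR ((x , P) ∷ (y , Q) ∷ []) → t ∈ P → t ∈ Q →
               CoveredBy P′ Q′ t → CoveredBy P′ Q′ u → CoveredBy P Q u
    transfer (((_ , P≢Q) ∷ []) ∷ _ , (P∈ , _) ∷ (Q∈ , _) ∷ []) t∈P t∈Q covt covu with covt P∈ t∈P | covt Q∈ t∈Q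
    ... | inj₁ refl | inj₁ refl = contradiction refl P≢Q
    ... | inj₁ refl | inj₂ refl = covu
    ... | inj₂ refl | inj₁ refl = coveredBy-swap covu
    ... | inj₂ refl | inj₂ refl = contradiction refl P≢Q

    module Rerouting {x y w : Fin m} (x≢y : x ≢ y) (x≢w : x ≢ w) (y≢w : y ≢ w) where

      triple : ∀ {A B C} → A ≢ B → A ≢ C → B ≢ C →
               A ∈ₗ sets × x ∈ A → B ∈ₗ sets × y ∈ B → C ∈ₗ sets × w ∈ C →
               SDR ((x , A) ∷ (y , B) ∷ (w , C) ∷ [])
      triple A≢B A≢C B≢C vx vy vw =
        ((x≢y , A≢B) ∷ (x≢w , A≢C) ∷ []) ∷ ((y≢w , B≢C) ∷ []) ∷ [] ∷ [] , vx ∷ vy ∷ vw ∷ []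

    -- If x lies in a third set R, then Hall's condition for x, y and w can be
    -- met by rerouting P, Q and R among the three elements.
    triple-SDR : ∀ {x y w P Q R} → SDR ((x , P) ∷ (y , Q) ∷ []) →
                 R ∈ₗ sets → x ∈ R → R ≢ P → R ≢ Q → x ≢ w → y ≢ w →
                 ∃ λ A → ∃ λ B → ∃ λ C → SDR ((x , A) ∷ (y , B) ∷ (w , C) ∷ [])
    triple-SDR {x} {y} {w} {P} {Q} {R} (((x≢y , P≢Q) ∷ []) ∷ _ , (P∈ , x∈P) ∷ (Q∈ , y∈Q) ∷ [])
      R∈ x∈R R≢P R≢Q x≢w y≢w with w ∈? P | y ∈? P | coveredOrEscapes P Q w | coveredOrEscapes P Q y
    ... | _       | _       | inj₂ (C , C∈ , w∈C , C≢P , C≢Q) | _ =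
      _ , _ , _ , triple P≢Q (C≢P ∘ sym) (C≢Q ∘ sym) (P∈ , x∈P) (Q∈ , y∈Q) (C∈ , w∈C)
      where open Rerouting x≢y x≢w y≢w
    -- From here on `w` lies in no set besides `P` and `Q`, so one of these is freed for it by
    -- moving `x` to `R` or `y` to a third set.
    ... | yes w∈P | _       | inj₁ _    | _ =
      _ , _ , _ , triple R≢Q R≢P (P≢Q ∘ sym) (R∈ , x∈R) (Q∈ , y∈Q) (P∈ , w∈P)
      where open Rerouting x≢y x≢w y≢w
    ... | no  w∉P | yes y∈P | inj₁ covw | _ =
      _ , _ , _ , triple R≢P R≢Q P≢Q (R∈ , x∈R) (P∈ , y∈P) (Q∈ , covered-∈ covw w∉P)
      where open Rerouting x≢y x≢w y≢w
    ... | no  w∉P | no  y∉P | inj₁ covw | inj₂ (S , S∈ , y∈S , S≢P , S≢Q) =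
      _ , _ , _ , triple (S≢P ∘ sym) P≢Q S≢Q (P∈ , x∈P) (S∈ , y∈S) (Q∈ , covered-∈ covw w∉P)
      where open Rerouting x≢y x≢w y≢w
    ... | no  w∉P | no  y∉P | inj₁ covw | inj₁ covy =
      contradiction (avoid-injective (coveredBy-swap covy) (coveredBy-swap covw) y∉P w∉P) y≢w

    -- By `triple-SDR`, every further element is independent of `x` and `y`, so their line has no
    -- third point.
    pair-flat : ∀ {x y P Q R} → SDR ((x , P) ∷ (y , Q) ∷ []) →
                R ∈ₗ sets → x ∈ R → R ≢ P → R ≢ Q → IsFlat (⁅ x ⁆ ∪ ⁅ y ⁆)
    pair-flat {x} {y} sdr R∈ x∈R R≢P R≢Q = isFlat 2
      (λ _ I⊆ → ≤-trans (p⊆q⇒∣p∣≤∣q∣ I⊆) (≤-trans (∣p∪q∣≤∣p∣+∣q∣ ⁅ x ⁆ ⁅ y ⁆)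
        (+-mono-≤ (≤-reflexive (∣⁅x⁆∣≡1 x)) (≤-reflexive (∣⁅x⁆∣≡1 y)))))
      λ {w} w∉ →
        let _ , _ , _ , sdr₃ = triple-SDR {w = w} sdr R∈ x∈R R≢P R≢Q
              (λ { refl → w∉ x∈xy }) (λ { refl → w∉ y∈xy })
        in _ , sdr₃ , p⊆p∪q _ x∈xy ∷ p⊆p∪q _ y∈xy ∷ q⊆p∪q _ _ (x∈⁅x⁆ w) ∷ [] , ≤-refl
      where
      x∈xy : x ∈ ⁅ x ⁆ ∪ ⁅ y ⁆
      x∈xy = p⊆p∪q _ (x∈⁅x⁆ x)

      y∈xy : y ∈ ⁅ x ⁆ ∪ ⁅ y ⁆
      y∈xy = q⊆p∪q _ _ (x∈⁅x⁆ y)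

    -- As soon as `x` or `y` escapes to a third set, `pair-flat` applies, with the roles exchanged
    -- in the case of `y`.
    line : ∀ {x y P Q} → SDR ((x , P) ∷ (y , Q) ∷ []) →
           (CoveredBy P Q x × CoveredBy P Q y) ⊎ IsFlat (⁅ x ⁆ ∪ ⁅ y ⁆)
    line {x} {y} {P} {Q} sdr@(((x≢y , P≢Q) ∷ []) ∷ _ , vx ∷ vy ∷ []) with coveredOrEscapes P Q x | coveredOrEscapes P Q y
    ... | inj₁ covx | inj₁ covy = inj₁ (covx , covy)
    ... | inj₂ (R , R∈ , x∈R , R≢P , R≢Q) | _ = inj₂ (pair-flat sdr R∈ x∈R R≢P R≢Q)
    ... | _ | inj₂ (R , R∈ , y∈R , R≢P , R≢Q) = inj₂ (subst IsFlat (∪-comm ⁅ y ⁆ ⁅ x ⁆)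
      (pair-flat (((x≢y ∘ sym , P≢Q ∘ sym) ∷ []) ∷ [] ∷ [] , vy ∷ vx ∷ []) R∈ y∈R R≢Q R≢P))

    -- Collinearity is recorded through the two sets that alone meet the three points; this is what
    -- lets two lines with a common point be compared.
    record Collinear (x y z : Fin m) : Set where
      field
        {P Q}    : Subset m
        sdr      : SDR ((x , P) ∷ (y , Q) ∷ [])
        coveredˣ : CoveredBy P Q x
        coveredʸ : CoveredBy P Q y
        coveredᶻ : CoveredBy P Q z

    -- The flat `⁅ x ⁆ ∪ ⁅ y ⁆` would have to contain the third point `z`, so `line` leaves only the
    -- case of two covering sets, and then `z` lies in the flat `span P Q`.
    collinear : ∀ {x y z} → x ≢ y → z ≢ x → z ≢ y →
                (∀ (F : Flat) → x ∈ proj₁ F → y ∈ proj₁ F → z ∈ proj₁ F) → Collinear x y z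
    collinear {x} {y} x≢y z≢x z≢y closed with pair-SDR x≢y
    ... | P , Q , sdr with line sdr
    ...   | inj₁ (covx , covy) = record
      { sdr = sdr ; coveredˣ = covx ; coveredʸ = covy
      ; coveredᶻ = ∈-span⁻ (closed (span P Q , span-flat sdr (∈-span⁺ covx) (∈-span⁺ covy))
          (∈-span⁺ covx) (∈-span⁺ covy))
      }
    ...   | inj₂ flat with x∈p∪q⁻ ⁅ x ⁆ ⁅ y ⁆
                             (closed (⁅ x ⁆ ∪ ⁅ y ⁆ , flat) (p⊆p∪q _ (x∈⁅x⁆ x)) (q⊆p∪q _ _ (x∈⁅x⁆ y)))
    ...     | inj₁ z∈x = contradiction (x∈⁅y⁆⇒x≡y x z∈x) z≢x
    ...     | inj₂ z∈y = contradiction (x∈⁅y⁆⇒x≡y y z∈y) z≢y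

    -- At most one point of a line lies in P only, and at most one in Q only.
    inBoth : ∀ {x y z} (c : Collinear x y z) → let open Collinear c in z ≢ x → z ≢ y →
             (x ∈ P × x ∈ Q) ⊎ (y ∈ P × y ∈ Q) ⊎ (z ∈ P × z ∈ Q)
    inBoth {x} {y} {z} record { P = P ; Q = Q ; sdr = (_ , (_ , x∈P) ∷ (_ , y∈Q) ∷ [])
                              ; coveredˣ = covx ; coveredʸ = covy ; coveredᶻ = covz } z≢x z≢y
      with x ∈? Q | y ∈? P | z ∈? P | z ∈? Q
    ... | yes x∈Q | _ | _ | _ = inj₁ (x∈P , x∈Q)
    ... | _ | yes y∈P | _ | _ = inj₂ (inj₁ (y∈P , y∈Q))
    ... | _ | _ | yes z∈P | yes z∈Q = inj₂ (inj₂ (z∈P , z∈Q))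
    ... | no x∉Q | _ | _ | no z∉Q = contradiction (avoid-injective covz covx z∉Q x∉Q) z≢x
    ... | _ | no y∉P | no z∉P | _ = contradiction (avoid-injective (coveredBy-swap covz) (coveredBy-swap covy) z∉P y∉P) z≢y

    -- The point of xyz in both P and Q drags its second line into span P Q, which
    -- is the line xyz itself.
    no-crossed-line :
      ∀ {x y z F} (c : Collinear x y z) → z ≢ x → z ≢ y →
      (∀ {t} → t ≡ x ⊎ t ≡ y ⊎ t ≡ z → ∃₂ λ u v → Collinear t u v × u ∉ F) →
      IsFlat F → x ∈ F → y ∈ F → (∀ (F′ : Flat) → x ∈ proj₁ F′ → y ∈ proj₁ F′ → F ⊆ proj₁ F′) → Empty.⊥
    no-crossed-line {x} {y} {z} {F} c z≢x z≢y crossing flat x∈F y∈F least =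
      [ escape (inj₁ refl) , [ escape (inj₂ (inj₁ refl)) , escape (inj₂ (inj₂ refl)) ]′ ]′ (inBoth c z≢x z≢y)
      where
      open Collinear c
      escape : ∀ {t} → t ≡ x ⊎ t ≡ y ⊎ t ≡ z → t ∈ P × t ∈ Q → Empty.⊥
      escape which (t∈P , t∈Q) with crossing which
      ... | u , v , c′ , u∉F = u∉F (span-minimal sdr flat x∈F y∈F
        (least (span P Q , span-flat sdr (∈-span⁺ coveredˣ) (∈-span⁺ coveredʸ)) (∈-span⁺ coveredˣ) (∈-span⁺ coveredʸ))
        (∈-span⁺ (transfer sdr t∈P t∈Q (Collinear.coveredˣ c′) (Collinear.coveredʸ c′))))

    -- An element in exactly two sets lies in both `P` and `Q`, hence its `E` is the whole ground
    -- set; `inBoth` provides such an element.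
    length-ℰ≡1 : ∀ {x y z} (c : Collinear x y z) → z ≢ x → z ≢ y →
                 (∀ w → CoveredBy (Collinear.P c) (Collinear.Q c) w) → length ℰ ≡ 1
    length-ℰ≡1 c@record { P = P ; Q = Q ; sdr = (((_ , P≢Q) ∷ []) ∷ _ , (P∈ , _) ∷ (Q∈ , _) ∷ []) } z≢x z≢y covered =
      [ conclude , [ conclude , conclude ]′ ]′ (inBoth c z≢x z≢y)
      where
      open DecSubset _≟ˢ_ using () renaming (_⊆?_ to _⊆ₗ?_)

      pair? : ∀ x → Dec (length (meeting ⁅ x ⁆) ≡ 2)
      pair? x = length (meeting ⁅ x ⁆) ≟ℕ 2

      PorQ : ∀ {x C} → C ∈ₗ meeting ⁅ x ⁆ → C ≡ P ⊎ C ≡ Q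
      PorQ {x} C∈ = covered x (proj₁ (∈-meeting⁻ C∈)) (proj₂ (∈-meeting⁻ C∈))

      E≡⊤ : ∀ {x} → length (meeting ⁅ x ⁆) ≡ 2 → E x ≡ ⊤
      E≡⊤ {x} two with length≡2⇒both (meeting-unique ⁅ x ⁆) two PorQ
      ... | P∈x , Q∈x = ⊆-antisym ⊆⊤ λ {y} _ → ∈-separate⁺ (λ y → meeting ⁅ y ⁆ ⊆ₗ? meeting ⁅ x ⁆)
        λ C∈ → [ (λ { refl → P∈x }) , (λ { refl → Q∈x }) ]′ (PorQ C∈)

      conclude : ∀ {t} → t ∈ P × t ∈ Q → length ℰ ≡ 1
      conclude {t} (t∈P , t∈Q) = unique-length (deduplicate-! _≟ˢ_ _) ([] ∷ []) to from
        where
        two : length (meeting ⁅ t ⁆) ≡ 2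
        two = unique-length (meeting-unique ⁅ t ⁆) ((P≢Q ∷ []) ∷ [] ∷ [])
          ([ here , there ∘ here ]′ ∘ PorQ)
          (λ { (here refl) → ∈-meeting⁺ P∈ t∈P ; (there (here refl)) → ∈-meeting⁺ Q∈ t∈Q })

        to : ∀ {S} → S ∈ₗ ℰ → S ∈ₗ ⊤ ∷ []
        to S∈ with ∈-map⁻ E (∈-deduplicate⁻ _≟ˢ_ (map E (filter pair? (allFin m))) S∈)
        ... | x , x∈ , refl = here (E≡⊤ (proj₂ (∈-filter⁻ pair? {xs = allFin m} x∈)))

        from : ∀ {S} → S ∈ₗ ⊤ ∷ [] → S ∈ₗ ℰ
        from (here refl) = subst (_∈ₗ ℰ) (E≡⊤ two)
          (∈-deduplicate⁺ _≟ˢ_ (∈-map⁺ E (∈-filter⁺ pair? (∈-allFin t) two)))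

-- Dowling lattices

-- Pigeonhole: punching out a missed value would inject `Fin m` into a smaller set.
injective⇒surjective : ∀ {m n} {f : Fin m → Fin n} → n ≤ m → Injective _≡_ _≡_ f → ∀ i → ∃ λ j → f j ≡ i
injective⇒surjective {m} {suc n} {f} n<m inj i with Fin.any? (λ j → f j ≟ i)
... | yes hit = hit
... | no miss = contradiction
  (≤-trans n<m (injective⇒≤ (λ {j} {k} eq → inj (punchOut-injective (away j) (away k) eq)))) 1+n≰n
  where
  away : ∀ j → i ≢ f j
  away j i≡fj = miss (j , sym i≡fj)

module Dowling {c ℓ : Level} (G : Group c ℓ) where

  private module G = Group G
  open G using (_≈_; _∙_; ε; _⁻¹)
  open PartialGPartition
  open _≤ᴰ_

  module _ {n : ℕ} where

    infix 4 _≼_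
    _≼_ : PartialGPartition G n → PartialGPartition G n → Set _
    _≼_ = _≤ᴰ_ G n

    zero⊎block : ∀ (P : PartialGPartition G n) x → x ∈ zeroBlock P ⊎ ∃ λ i → x ∈ block P i
    zero⊎block P x with x ∈? zeroBlock P
    ... | yes x∈Z = inj₁ x∈Z
    ... | no  x∉Z with ∈⋃⁻ (tabulate (block P)) (subst (x ∈_) (sym (exhaust P)) (x∉p⇒x∈∁p x∉Z))
    ...   | B , B∈ , x∈B with ∈-tabulate⁻ B∈
    ...     | i , refl = inj₂ (i , x∈B)

    zero∩block : ∀ (P : PartialGPartition G n) {x i} → x ∈ zeroBlock P → x ∉ block P i
    zero∩block P {x} {i} x∈Z x∈B =
      x∈∁p⇒x∉p (subst (x ∈_) (exhaust P) (∈⋃⁺ (∈-tabulate⁺ i) x∈B)) x∈Z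

    label-irrelevant : ∀ (P : PartialGPartition G n) {i x} (p q : x ∈ block P i) → label P i p ≈ label P i q
    label-irrelevant P p q = G.reflexive (cong (label P _) (∈-irrelevant p q))

    blockBelow : ∀ {P Q} → P ≼ Q → ∀ {j x} → x ∈ block Q j →
                 ∃ λ i → x ∈ block P i × block P i ⊆ block Q j
    blockBelow {P} P≼Q {j} {x} x∈Qⱼ with unions P≼Q j
    ... | is , eq with ∈⋃⁻ (map (block P) is) (subst (x ∈_) eq x∈Qⱼ)
    ...   | _ , B∈ , x∈B with ∈-map⁻ (block P) B∈
    ...     | i , i∈ , refl = i , x∈B , λ {y} y∈ → subst (y ∈_) (sym eq) (∈⋃⁺ (∈-map⁺ (block P) i∈) y∈)

    block⊆ : ∀ {P Q} → P ≼ Q → ∀ {i j x} → x ∈ block P i → x ∈ block Q j → block P i ⊆ block Q j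
    block⊆ {P} P≼Q x∈Pᵢ x∈Qⱼ with blockBelow P≼Q x∈Qⱼ
    ... | i′ , x∈Pᵢ′ , ⊆Qⱼ with disjoint P x∈Pᵢ x∈Pᵢ′
    ...   | refl = ⊆Qⱼ

    -- It suffices to place each block of `P`. A point of a block of `Q` lies outside both zero
    -- blocks, hence in a block of `P`, and disjointness forces that block to be placed in the given
    -- one.
    ≼-intro : ∀ {P Q} → zeroBlock P ⊆ zeroBlock Q →
              (∀ i → block P i ⊆ zeroBlock Q ⊎ ∃ λ j → block P i ⊆ block Q j × Translate G n P Q i j) →
              P ≼ Q
    ≼-intro {P} {Q} Z⊆ placed = record
      { zeroBlock⊆ = Z⊆
      ; unions     = λ j → below j , ⊆-antisym (to j) (from j)
      ; labels     = translate
      }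
      where
      below : Fin (size Q) → List (Fin (size P))
      below j = filter (λ i → block P i ⊆? block Q j) (allFin (size P))

      to : ∀ j → block Q j ⊆ ⋃ (map (block P) (below j))
      to j {x} x∈Qⱼ with zero⊎block P x
      ... | inj₁ x∈Z = contradiction x∈Qⱼ (zero∩block Q (Z⊆ x∈Z))
      ... | inj₂ (i , x∈Pᵢ) with placed i
      ...   | inj₁ ⊆Z = contradiction x∈Qⱼ (zero∩block Q (⊆Z x∈Pᵢ))
      ...   | inj₂ (j′ , ⊆Qⱼ′ , _) with disjoint Q x∈Qⱼ (⊆Qⱼ′ x∈Pᵢ)
      ...     | refl = ∈⋃⁺ (∈-map⁺ (block P) (∈-filter⁺ (λ i → block P i ⊆? block Q j) (∈-allFin i) ⊆Qⱼ′)) x∈Pᵢ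

      from : ∀ j → ⋃ (map (block P) (below j)) ⊆ block Q j
      from j x∈ with ∈⋃⁻ (map (block P) (below j)) x∈
      ... | _ , B∈ , x∈B with ∈-map⁻ (block P) B∈
      ...   | i , i∈ , refl = proj₂ (∈-filter⁻ (λ i → block P i ⊆? block Q j) {xs = allFin (size P)} i∈) x∈B

      translate : ∀ {i j} → block P i ⊆ block Q j → Translate G n P Q i j
      translate {i} Pᵢ⊆Qⱼ with placed i | nonempty P i
      ... | inj₁ ⊆Z | x , x∈Pᵢ = contradiction (Pᵢ⊆Qⱼ x∈Pᵢ) (zero∩block Q (⊆Z x∈Pᵢ))
      ... | inj₂ (j′ , ⊆Qⱼ′ , t) | x , x∈Pᵢ with disjoint Q (Pᵢ⊆Qⱼ x∈Pᵢ) (⊆Qⱼ′ x∈Pᵢ)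
      ...   | refl = t

    size≤n : ∀ (P : PartialGPartition G n) → size P ≤ n
    size≤n P = injective⇒≤ {f = proj₁ ∘ nonempty P} λ {i} {j} eq →
      disjoint P (subst (_∈ block P i) eq (proj₂ (nonempty P i))) (proj₂ (nonempty P j))

    module _ {P Q : PartialGPartition G n} (P≼Q : P ≼ Q) where

      private
        part : Fin (size Q) → Fin (size P)
        part j = proj₁ (blockBelow P≼Q (proj₂ (nonempty Q j)))

        part⊆ : ∀ j → block P (part j) ⊆ block Q j
        part⊆ j = proj₂ (proj₂ (blockBelow P≼Q (proj₂ (nonempty Q j))))

        part-injective : Injective _≡_ _≡_ part
        part-injective {i} {j} eq with nonempty P (part i)
        ... | x , x∈ = disjoint Q (part⊆ i x∈) (part⊆ j (subst (λ k → x ∈ block P k) eq x∈))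

      -- The number of nonzero blocks is the corank. Every block of `Q` contains a block of `P`, and
      -- different blocks contain different ones.
      size-antitone : size Q ≤ size P
      size-antitone = injective⇒≤ part-injective

      -- Comparable elements of equal corank coincide: `part` is then bijective, so no block of `P`
      -- was merged or absorbed into the zero block, and the translations can be inverted.
      size≤⇒≽ : size P ≤ size Q → Q ≼ P
      size≤⇒≽ P≤Q = ≼-intro Z⊆ λ j → inj₂ (part j , Q⊆ j , translate j)
        where
        inPart : ∀ {x i} → x ∈ block P i → ∃ λ j → i ≡ part j × x ∈ block Q j
        inPart {i = i} x∈ with injective⇒surjective P≤Q part-injective i
        ... | j , refl = j , refl , part⊆ j x∈

        Z⊆ : zeroBlock Q ⊆ zeroBlock P
        Z⊆ {x} x∈Z with zero⊎block P x
        ... | inj₁ x∈ = x∈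
        ... | inj₂ (i , x∈Pᵢ) = contradiction (proj₂ (proj₂ (inPart x∈Pᵢ))) (zero∩block Q x∈Z)

        Q⊆ : ∀ j → block Q j ⊆ block P (part j)
        Q⊆ j {x} x∈Qⱼ with zero⊎block P x
        ... | inj₁ x∈Z = contradiction x∈Qⱼ (zero∩block Q (zeroBlock⊆ P≼Q x∈Z))
        ... | inj₂ (i , x∈Pᵢ) with inPart x∈Pᵢ
        ...   | j′ , refl , x∈Qⱼ′ with disjoint Q x∈Qⱼ x∈Qⱼ′
        ...     | refl = x∈Pᵢ

        translate : ∀ j → Translate G n Q P j (part j)
        translate j with labels P≼Q (part⊆ j)
        ... | g , eq = g ⁻¹ , λ q p → G.sym (G.trans (G.∙-congˡ (eq p q)) (\\-leftDividesʳ g _))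
          where open GroupProperties G

    -- x and y, carrying labels g and h, lie together in Q up to a common translation.
    Joined : PartialGPartition G n → Fin n × G.Carrier → Fin n × G.Carrier → Set _
    Joined Q (x , g) (y , h) =
      (x ∈ zeroBlock Q × y ∈ zeroBlock Q) ⊎
      ∃ λ j → Σ (x ∈ block Q j) λ p → Σ (y ∈ block Q j) λ q → ∃ λ u →
        label Q j p ≈ u ∙ g × label Q j q ≈ u ∙ h

    private
      divides : ∀ {a u} g → a ≈ u ∙ g → u ≈ a ∙ g ⁻¹
      divides {a} {u} g eq = G.sym (G.trans (G.∙-congʳ eq) (//-rightDividesʳ g u))
        where open GroupProperties G

      divides⁻¹ : ∀ a g → a ≈ (a ∙ g ⁻¹) ∙ g
      divides⁻¹ a g = G.sym (//-rightDividesˡ g a)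
        where open GroupProperties G

    joined-refl : ∀ Q a → Joined Q a a
    joined-refl Q (x , g) with zero⊎block Q x
    ... | inj₁ x∈Z = inj₁ (x∈Z , x∈Z)
    ... | inj₂ (j , x∈) = inj₂ (j , x∈ , x∈ , label Q j x∈ ∙ g ⁻¹ , divides⁻¹ _ g , divides⁻¹ _ g)

    joined-sym : ∀ Q {a b} → Joined Q a b → Joined Q b a
    joined-sym Q (inj₁ (x∈ , y∈)) = inj₁ (y∈ , x∈)
    joined-sym Q (inj₂ (j , p , q , u , ep , eq)) = inj₂ (j , q , p , u , eq , ep)

    joined-congˡ : ∀ Q {x g h b} → g ≈ h → Joined Q (x , g) b → Joined Q (x , h) b
    joined-congˡ Q g≈h (inj₁ zs) = inj₁ zs
    joined-congˡ Q g≈h (inj₂ (j , p , q , u , ep , eq)) = inj₂ (j , p , q , u , G.trans ep (G.∙-congˡ g≈h) , eq)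

    joined-trans : ∀ Q {a b d} → Joined Q a b → Joined Q b d → Joined Q a d
    joined-trans Q (inj₁ (x∈ , _)) (inj₁ (_ , z∈)) = inj₁ (x∈ , z∈)
    joined-trans Q (inj₁ (_ , y∈Z)) (inj₂ (_ , y∈ , _)) = contradiction y∈ (zero∩block Q y∈Z)
    joined-trans Q (inj₂ (_ , _ , y∈ , _)) (inj₁ (y∈Z , _)) = contradiction y∈ (zero∩block Q y∈Z)
    joined-trans Q {b = y , h} (inj₂ (j , p , q , u , ep , eq)) (inj₂ (k , q′ , r , v , eq′ , er)) with disjoint Q q q′
    -- The translations `u` and `v` agree, both being the label of `y` times the inverse of `h`.
    ... | refl = inj₂ (j , p , r , u , ep , G.trans er (G.∙-congʳ (G.trans (divides h eq′)
      (G.trans (G.∙-congʳ (label-irrelevant Q q′ q)) (G.sym (divides h eq))))))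

    joined-zero : ∀ Q {x y g h} → Joined Q (x , g) (y , h) → x ∈ zeroBlock Q → y ∈ zeroBlock Q
    joined-zero Q (inj₁ (_ , y∈)) _ = y∈
    joined-zero Q (inj₂ (_ , x∈ , _)) x∈Z = contradiction x∈ (zero∩block Q x∈Z)

    -- The class map κ sends the zero block to nothing; r picks a point of each other block.
    module FromClasses {s} (κ : Fin n → Maybe (Fin s)) (lab : Fin n → G.Carrier)
                       (r : Fin s → Fin n) (κ∘r : ∀ i → κ (r i) ≡ just i) where

      private
        inClass? : ∀ (v : Maybe (Fin s)) x → Dec (κ x ≡ v)
        inClass? v x = Maybe.≡-dec _≟_ (κ x) v

        class : Maybe (Fin s) → Subset n
        class v = Vec.tabulate (does ∘ inClass? v)

        ∈-class⁺ : ∀ {v x} → κ x ≡ v → x ∈ class v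
        ∈-class⁺ {v} = ∈-separate⁺ (inClass? v)

        ∈-class⁻ : ∀ {v x} → x ∈ class v → κ x ≡ v
        ∈-class⁻ {v} = ∈-separate⁻ (inClass? v)

        exhausted : ⋃ (tabulate (class ∘ just)) ≡ ∁ (class nothing)
        exhausted = ⊆-antisym to from
          where
          to : ⋃ (tabulate (class ∘ just)) ⊆ ∁ (class nothing)
          to x∈ with ∈⋃⁻ (tabulate (class ∘ just)) x∈
          ... | _ , B∈ , x∈B with ∈-tabulate⁻ B∈
          ...   | i , refl = x∉p⇒x∈∁p λ x∈Z → contradiction (trans (sym (∈-class⁻ x∈B)) (∈-class⁻ x∈Z)) λ ()

          from : ∁ (class nothing) ⊆ ⋃ (tabulate (class ∘ just))
          from {x} x∈ with κ x in eq
          ... | nothing = contradiction (∈-class⁺ eq) (x∈∁p⇒x∉p x∈)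
          ... | just i  = ∈⋃⁺ (∈-tabulate⁺ i) (∈-class⁺ eq)

      partition : PartialGPartition G n
      partition = record
        { zeroBlock = class nothing
        ; size      = s
        ; block     = class ∘ just
        ; nonempty  = λ i → r i , ∈-class⁺ (κ∘r i)
        ; disjoint  = λ p q → Maybe.just-injective (trans (sym (∈-class⁻ p)) (∈-class⁻ q))
        ; exhaust   = exhausted
        ; label     = λ _ {x} _ → lab x
        }

      zero⇒κ : ∀ {x} → x ∈ zeroBlock partition → κ x ≡ nothing
      zero⇒κ = ∈-class⁻

      joined⇒κ : ∀ {x y g h} → Joined partition (x , g) (y , h) → κ x ≡ κ y
      joined⇒κ (inj₁ (p , q))         = trans (∈-class⁻ p) (sym (∈-class⁻ q))
      joined⇒κ (inj₂ (j , p , q , _)) = trans (∈-class⁻ p) (sym (∈-class⁻ q))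

      joined⇒label : ∀ {x y g h} → κ x ≢ nothing → Joined partition (x , g) (y , h) →
                     ∃ λ u → lab x ≈ u ∙ g × lab y ≈ u ∙ h
      joined⇒label κx≢ (inj₁ (p , _))           = contradiction (∈-class⁻ p) κx≢
      joined⇒label _   (inj₂ (_ , _ , _ , eqs)) = eqs

      -- If the representative falls into the zero block of `Q`, its class follows; otherwise the
      -- translation read off at the representative serves the whole class.
      ≼⁺ : ∀ {Q} → (∀ {x} → κ x ≡ nothing → x ∈ zeroBlock Q) →
           (∀ {x i} → κ x ≡ just i → Joined Q (x , lab x) (r i , lab (r i))) → partition ≼ Q
      ≼⁺ {Q} zeros joins = ≼-intro (zeros ∘ ∈-class⁻) placed
        where
        placed : ∀ i → class (just i) ⊆ zeroBlock Q ⊎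
                       ∃ λ j → class (just i) ⊆ block Q j × Translate G n partition Q i j
        placed i with zero⊎block Q (r i)
        ... | inj₁ ri∈Z = inj₁ λ x∈ → joined-zero Q (joined-sym Q (joins (∈-class⁻ x∈))) ri∈Z
        ... | inj₂ (j , ri∈) = inj₂ (j , sub , label Q j ri∈ ∙ lab (r i) ⁻¹ , translated)
          where
          sub : class (just i) ⊆ block Q j
          sub x∈ with joins (∈-class⁻ x∈)
          ... | inj₁ (_ , ri∈Z) = contradiction ri∈ (zero∩block Q ri∈Z)
          ... | inj₂ (k , x∈Qₖ , ri∈′ , _) with disjoint Q ri∈ ri∈′
          ...   | refl = x∈Qₖ

          translated : ∀ {x} (x∈ : x ∈ class (just i)) (x∈Q : x ∈ block Q j) →
                       label Q j x∈Q ≈ (label Q j ri∈ ∙ lab (r i) ⁻¹) ∙ lab x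
          translated x∈ x∈Q with joins (∈-class⁻ x∈)
          ... | inj₁ (x∈Z , _) = contradiction x∈Q (zero∩block Q x∈Z)
          ... | inj₂ (k , p , q , u , ep , eq) with disjoint Q ri∈ q
          ...   | refl = G.trans (label-irrelevant Q x∈Q p) (G.trans ep
            (G.∙-congʳ (G.trans (divides _ eq) (G.∙-congʳ (label-irrelevant Q q ri∈)))))

      ≼⁻-zero : ∀ {Q} → partition ≼ Q → ∀ {x} → κ x ≡ nothing → x ∈ zeroBlock Q
      ≼⁻-zero ≼Q = zeroBlock⊆ ≼Q ∘ ∈-class⁺

      ≼⁻-joined : ∀ {Q} → partition ≼ Q → ∀ {x y i} → κ x ≡ just i → κ y ≡ just i →
                  Joined Q (x , lab x) (y , lab y)
      ≼⁻-joined {Q} ≼Q {x} {y} {i} κx κy with zero⊎block Q x | zero⊎block Q y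
      ... | inj₁ x∈Z | inj₁ y∈Z = inj₁ (x∈Z , y∈Z)
      ... | inj₁ x∈Z | inj₂ (j , y∈) =
        contradiction (block⊆ ≼Q (∈-class⁺ κy) y∈ (∈-class⁺ κx)) (zero∩block Q x∈Z)
      ... | inj₂ (j , x∈) | _ = let Pᵢ⊆Qⱼ = block⊆ ≼Q (∈-class⁺ κx) x∈ ; u , eq = labels ≼Q Pᵢ⊆Qⱼ in
        inj₂ (j , x∈ , Pᵢ⊆Qⱼ (∈-class⁺ κy) , u , eq (∈-class⁺ κx) x∈ , eq (∈-class⁺ κy) _)

  -- With at most one block on two points, either some point is in the zero block or both share that
  -- block; so `P` lies above an atom.
  coatomCases : (P : PartialGPartition G 2) → size P ≤ 1 →
                zero ∈ zeroBlock P ⊎ suc zero ∈ zeroBlock P ⊎ ∃ λ g → Joined P (zero , g) (suc zero , ε)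
  coatomCases P size≤1 with zero⊎block P zero | zero⊎block P (suc zero)
  ... | inj₁ 0∈Z | _ = inj₁ 0∈Z
  ... | _ | inj₁ 1∈Z = inj₂ (inj₁ 1∈Z)
  ... | inj₂ (i , p) | inj₂ (j , q) with index-irrelevant size≤1 i j
    where
    index-irrelevant : ∀ {s} → s ≤ 1 → (i j : Fin s) → i ≡ j
    index-irrelevant (s≤s z≤n) zero zero = refl
  -- Translating by the inverse of the second label normalises that label to `ε`.
  ...   | refl = inj₂ (inj₂ (label P i q ⁻¹ ∙ label P i p ,
    inj₂ (i , p , q , label P i q , G.sym (\\-leftDividesˡ _ _) , G.sym (G.identityʳ _))))
    where open GroupProperties G

  module Bottom n = FromClasses {n} just (const ε) id (λ _ → refl)

  -- All points but `p` head distinct blocks with label `ε`, indexed through `punchIn p`. For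
  -- `t = nothing`, `p` alone is the zero block; for `t = just i`, it joins `punchIn p i` with label
  -- `g`.
  module Atom {n} (p : Fin (suc n)) (t : Maybe (Fin n)) (g : G.Carrier) =
    FromClasses (insertAt just p t) (insertAt (const ε) p g) (punchIn p) (insertAt-punchIn just p t)

  atom : ∀ {n} → Fin (suc n) → Maybe (Fin n) → G.Carrier → PartialGPartition G (suc n)
  atom = Atom.partition

  module _ {n} (p : Fin (suc n)) where

    private
      split : ∀ x → x ≡ p ⊎ ∃ λ i → x ≡ punchIn p i
      split x with p ≟ x
      ... | yes p≡x = inj₁ (sym p≡x)
      ... | no  p≢x = inj₂ (_ , sym (punchIn-punchOut p≢x))

    zeroAtom≼⁺ : ∀ {g Q} → p ∈ zeroBlock Q → atom p nothing g ≼ Q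
    zeroAtom≼⁺ {g} {Q} p∈Z = Atom.≼⁺ p nothing g zeros joins
      where
      zeros : ∀ {x} → insertAt just p nothing x ≡ nothing → x ∈ zeroBlock Q
      zeros {x} eq with split x
      ... | inj₁ refl = p∈Z
      ... | inj₂ (i , refl) = contradiction (trans (sym (insertAt-punchIn just p nothing i)) eq) λ ()

      joins : ∀ {x i} → insertAt just p nothing x ≡ just i → Joined Q (x , _) (punchIn p i , _)
      joins {x} eq with split x
      ... | inj₁ refl = contradiction (trans (sym (insertAt-lookup just p nothing)) eq) λ ()
      ... | inj₂ (i , refl) with trans (sym (insertAt-punchIn just p nothing i)) eq
      ...   | refl = joined-refl Q _

    zeroAtom≼⁻ : ∀ {g Q} → atom p nothing g ≼ Q → p ∈ zeroBlock Q
    zeroAtom≼⁻ {g} a≼Q = Atom.≼⁻-zero p nothing g a≼Q (insertAt-lookup just p nothing)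

    joinAtom≼⁺ : ∀ {g Q} i → Joined Q (p , g) (punchIn p i , ε) → atom p (just i) g ≼ Q
    joinAtom≼⁺ {g} {Q} i joined = Atom.≼⁺ p (just i) g zeros joins
      where
      zeros : ∀ {x} → insertAt just p (just i) x ≡ nothing → x ∈ zeroBlock Q
      zeros {x} eq with split x
      ... | inj₁ refl = contradiction (trans (sym (insertAt-lookup just p (just i))) eq) λ ()
      ... | inj₂ (j , refl) = contradiction (trans (sym (insertAt-punchIn just p (just i) j)) eq) λ ()

      joins : ∀ {x j} → insertAt just p (just i) x ≡ just j →
              Joined Q (x , insertAt (const ε) p g x) (punchIn p j , insertAt (const ε) p g (punchIn p j))
      joins {x} eq with split x
      joins eq | inj₁ refl with trans (sym (insertAt-lookup just p (just i))) eq
      ... | refl rewrite insertAt-lookup (const ε) p g | insertAt-punchIn (const ε) p g i = joined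
      joins eq | inj₂ (j , refl) with trans (sym (insertAt-punchIn just p (just i) j)) eq
      ... | refl = joined-refl Q _

    joinAtom≼⁻ : ∀ {g Q} i → atom p (just i) g ≼ Q → Joined Q (p , g) (punchIn p i , ε)
    joinAtom≼⁻ {g} {Q} i a≼Q
      with joined ← Atom.≼⁻-joined p (just i) g a≼Q
             (insertAt-lookup just p (just i)) (insertAt-punchIn just p (just i) i)
      rewrite insertAt-lookup (const ε) p g | insertAt-punchIn (const ε) p g i = joined

-- Points of the matroid as atoms of the Dowling lattice

module Coordinatised
  {m : ℕ} (𝒞 : Covering m) (simple : TransversalMatroid.IsSimple 𝒞)
  {c ℓ : Level} (G : Group c ℓ) (n : ℕ) (iso : L 𝒞 ≅ DowlingLattice G (suc n)) where

  open Covering 𝒞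
  open Flats PartialTransversal
  open TransversalMatroid 𝒞
  open Simple simple
  open Dowling G
  open PartialGPartition
  module D = Poset (DowlingLattice G (suc n))
  open IsOrderIsomorphism (proj₂ iso) using (mono; cancel; surjective) public

  ⟦_⟧ : Flat → PartialGPartition G (suc n)
  ⟦_⟧ = proj₁ iso

  ⟨_⟩ : Fin m → Flat
  ⟨ x ⟩ = ⁅ x ⁆ , ⁅⁆-flat x

  point≼ : ∀ {x} (F : Flat) → x ∈ proj₁ F → ⟦ ⟨ x ⟩ ⟧ ≼ ⟦ F ⟧
  point≼ {x} F x∈ = mono {⟨ x ⟩} {F} λ y∈ → subst (_∈ proj₁ F) (sym (x∈⁅y⁆⇒x≡y x y∈)) x∈

  ≼point : ∀ {x} (F : Flat) → ⟦ ⟨ x ⟩ ⟧ ≼ ⟦ F ⟧ → x ∈ proj₁ F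
  ≼point {x} F le = cancel {⟨ x ⟩} {F} le (x∈⁅x⁆ x)

  size-strict : ∀ (F F′ : Flat) {w} → proj₁ F ⊆ proj₁ F′ →
                w ∈ proj₁ F′ → w ∉ proj₁ F → size ⟦ F′ ⟧ < size ⟦ F ⟧
  size-strict F F′ F⊆F′ w∈ w∉ = ≰⇒> λ le →
    w∉ (cancel {F′} {F} (size≤⇒≽ (mono {F} {F′} F⊆F′) le) w∈)

  -- The empty flat has at most `suc n` blocks, and `⟨ x ⟩` is strictly above it.
  size-point : ∀ x → size ⟦ ⟨ x ⟩ ⟧ ≤ n
  size-point x = s≤s⁻¹ (≤-trans (size-strict (⊥ , ∅-flat) ⟨ x ⟩ (⊆-min _) (x∈⁅x⁆ x) ∉⊥) (size≤n ⟦ ⊥ , ∅-flat ⟧))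

  preimage : ∀ a → ∃ λ F → ⟦ F ⟧ ≼ a × a ≼ ⟦ F ⟧
  preimage a with surjective a
  ... | F , eq = F , D.reflexive (eq {F} refl) , D.reflexive (D.Eq.sym (eq {F} refl))

  Represents : Fin m → PartialGPartition G (suc n) → Set _
  Represents x a = ⟦ ⟨ x ⟩ ⟧ ≼ a × a ≼ ⟦ ⟨ x ⟩ ⟧

  represents-∈⁻ : ∀ {x a} (F : Flat) → Represents x a → x ∈ proj₁ F → a ≼ ⟦ F ⟧
  represents-∈⁻ F (_ , a≼x) x∈ = D.trans a≼x (point≼ F x∈)

  represents-∈⁺ : ∀ {x a} (F : Flat) → Represents x a → a ≼ ⟦ F ⟧ → x ∈ proj₁ F
  represents-∈⁺ F (x≼a , _) a≼F = ≼point F (D.trans x≼a a≼F)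

  represents-≡ : ∀ {x y a b} → Represents x a → Represents y b → x ≡ y → a ≼ b
  represents-≡ (_ , a≼x) (x≼b , _) refl = D.trans a≼x x≼b

  -- The flat of `a` is nonempty, since otherwise `a` would lie below the bottom element, which has
  -- `suc n` blocks. Any point of that flat has its image below `a` with no more blocks, which
  -- forces equality.
  realise : ∀ a → size a ≡ n → ∃ λ x → Represents x a
  realise a refl with preimage a
  ... | F , F≼a , a≼F with nonempty? (proj₁ F)
  ...   | yes (x , x∈F) = let x≼a = D.trans (point≼ F x∈F) F≼a in
    x , x≼a , size≤⇒≽ x≼a (size-point x)
  ...   | no empty with preimage (Bottom.partition (suc n))
  ...     | B , B≼ , _ = contradiction
    (size-antitone (D.trans a≼F (D.trans (mono {F} {B} λ x∈ → contradiction (_ , x∈) empty) B≼)))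
    1+n≰n

  -- Unfolding point would make comparing two points normalise the isomorphism.
  abstract
    point : Fin (suc n) → Maybe (Fin n) → Group.Carrier G → Fin m
    point p t g = proj₁ (realise (atom p t g) refl)

    point-represents : ∀ p t g → Represents (point p t g) (atom p t g)
    point-represents p t g = proj₂ (realise (atom p t g) refl)

  module _ {p : Fin (suc n)} {t : Maybe (Fin n)} {g : Group.Carrier G} (F : Flat) where

    ∈⇒atom≼ : point p t g ∈ proj₁ F → atom p t g ≼ ⟦ F ⟧
    ∈⇒atom≼ = represents-∈⁻ F (point-represents p t g)

    atom≼⇒∈ : atom p t g ≼ ⟦ F ⟧ → point p t g ∈ proj₁ F
    atom≼⇒∈ = represents-∈⁺ F (point-represents p t g)

  point≡⇒atom≼ : ∀ {p t g p′ t′ g′} → point p t g ≡ point p′ t′ g′ → atom p t g ≼ atom p′ t′ g′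
  point≡⇒atom≼ {p} {t} {g} {p′} {t′} {g′} =
    represents-≡ (point-represents p t g) (point-represents p′ t′ g′)

  -- Together with `join≡⇒κ` this tells points apart: equal points have comparable atoms, and at
  -- suitable indices the resulting equation of classes is absurd.
  zero≡⇒κ : ∀ {p g p′ t′ g′} → point p nothing g ≡ point p′ t′ g′ → insertAt just p′ t′ p ≡ nothing
  zero≡⇒κ {p} {p′ = p′} {t′} {g′} eq = Atom.zero⇒κ p′ t′ g′ (zeroAtom≼⁻ p (point≡⇒atom≼ eq))

  join≡⇒κ : ∀ {p i g p′ t′ g′} → point p (just i) g ≡ point p′ t′ g′ →
            insertAt just p′ t′ p ≡ insertAt just p′ t′ (punchIn p i)
  join≡⇒κ {p} {i} {p′ = p′} {t′} {g′} eq = Atom.joined⇒κ p′ t′ g′ (joinAtom≼⁻ p i (point≡⇒atom≼ eq))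

  -- A flat that joins `p` to `punchIn p i` and has `p` in its zero block has both there.
  zeroLine : ∀ p i {g} → Collinear (point p (just i) g) (point p nothing g) (point (punchIn p i) nothing g)
  zeroLine p i {g} = collinear
    (λ eq → contradiction (trans (sym (insertAt-lookup just p nothing))
      (trans (join≡⇒κ eq) (insertAt-punchIn just p nothing i))) λ ())
    (λ eq → contradiction (trans (sym (insertAt-punchIn just p (just i) i)) (zero≡⇒κ eq)) λ ())
    (λ eq → contradiction (trans (sym (insertAt-punchIn just p nothing i)) (zero≡⇒κ eq)) λ ())
    λ F e∈ z∈ → atom≼⇒∈ F (zeroAtom≼⁺ (punchIn p i)
      (joined-zero ⟦ F ⟧ (joinAtom≼⁻ p i (∈⇒atom≼ F e∈)) (zeroAtom≼⁻ p (∈⇒atom≼ F z∈))))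

-- Excluding Dowling lattices of rank at least three

module Merge {c ℓ : Level} (G : Group c ℓ) (k : ℕ) where

  -- This gives the join of `e₀₁` and `e₀₂`: the points 0, 1, 2 form one block, the others are
  -- singletons, and the zero block is empty.
  κ : Fin (3 + k) → Maybe (Fin (1 + k))
  κ zero                = just zero
  κ (suc zero)          = just zero
  κ (suc (suc zero))    = just zero
  κ (suc (suc (suc i))) = just (suc i)

  r : Fin (1 + k) → Fin (3 + k)
  r zero    = zero
  r (suc i) = suc (suc (suc i))

  κ∘r : ∀ i → κ (r i) ≡ just i
  κ∘r zero    = refl
  κ∘r (suc i) = refl

  κ≢nothing : ∀ x → κ x ≢ nothing
  κ≢nothing zero                ()
  κ≢nothing (suc zero)          ()
  κ≢nothing (suc (suc zero))    ()
  κ≢nothing (suc (suc (suc _))) ()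

  open Dowling.FromClasses G κ (const (Group.ε G)) r κ∘r public

module _ {m : ℕ} (𝒞 : Covering m) (simple : TransversalMatroid.IsSimple 𝒞) {c ℓ : Level} (G : Group c ℓ) where

  open Covering 𝒞
  open TransversalMatroid 𝒞
  open Simple simple
  open Dowling G
  open PartialGPartition
  private module G = Group G
  open G using (_≈_; _∙_; ε)

  rank≢3+k : ∀ k → ¬ (L 𝒞 ≅ DowlingLattice G (3 + k))
  rank≢3+k k iso = no-crossed-line {x = e₀₁} {e₀₂} {e₁₂} line₀₁₂ e₁₂≢e₀₁ e₁₂≢e₀₂ crossing (proj₂ Λ)
    (in-Λ zero zero refl refl) (in-Λ zero (suc zero) refl refl) least
    where
    open Coordinatised 𝒞 simple G (2 + k) iso
    module M = Merge G k

    e₀₁ e₀₂ e₁₂ : Fin m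
    e₀₁ = point zero (just zero) ε
    e₀₂ = point zero (just (suc zero)) ε
    e₁₂ = point (suc zero) (just (suc zero)) ε

    e₁₂≢e₀₁ : e₁₂ ≢ e₀₁
    e₁₂≢e₀₁ eq with () ← join≡⇒κ eq

    e₁₂≢e₀₂ : e₁₂ ≢ e₀₂
    e₁₂≢e₀₂ eq with () ← join≡⇒κ eq

    line₀₁₂ : Collinear e₀₁ e₀₂ e₁₂
    line₀₁₂ = collinear (λ eq → contradiction (join≡⇒κ eq) λ ()) e₁₂≢e₀₁ e₁₂≢e₀₂ λ F a∈ b∈ →
      -- Points 1 and 2 are joined through 0, which carries the same label `ε` in both atoms.
      atom≼⇒∈ F (joinAtom≼⁺ (suc zero) (suc zero) (joined-trans ⟦ F ⟧
        (joined-sym ⟦ F ⟧ (joinAtom≼⁻ zero zero (∈⇒atom≼ F a∈))) (joinAtom≼⁻ zero (suc zero) (∈⇒atom≼ F b∈))))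

    Λ : Flat
    Λ = proj₁ (preimage M.partition)

    Λ≼ : ⟦ Λ ⟧ ≼ M.partition
    Λ≼ = proj₁ (proj₂ (preimage M.partition))

    ≼Λ : M.partition ≼ ⟦ Λ ⟧
    ≼Λ = proj₂ (proj₂ (preimage M.partition))

    in-Λ : ∀ p i → M.κ p ≡ just zero → M.κ (punchIn p i) ≡ just zero → point p (just i) ε ∈ proj₁ Λ
    in-Λ p i κp κi = atom≼⇒∈ Λ (joinAtom≼⁺ p i (M.≼⁻-joined ≼Λ κp κi))

    -- The two atoms join 1 and 2 to 0, the representative of the only nontrivial class.
    least : ∀ (F : Flat) → e₀₁ ∈ proj₁ F → e₀₂ ∈ proj₁ F → proj₁ Λ ⊆ proj₁ F
    least F a∈ b∈ = cancel {Λ} {F} (D.trans Λ≼ (M.≼⁺ (⊥-elim ∘ M.κ≢nothing _) joins))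
      where
      joins : ∀ {x i} → M.κ x ≡ just i → Joined ⟦ F ⟧ (x , ε) (M.r i , ε)
      joins {zero}              refl = joined-refl ⟦ F ⟧ _
      joins {suc zero}          refl = joined-sym ⟦ F ⟧ (joinAtom≼⁻ zero zero (∈⇒atom≼ F a∈))
      joins {suc (suc zero)}    refl = joined-sym ⟦ F ⟧ (joinAtom≼⁻ zero (suc zero) (∈⇒atom≼ F b∈))
      joins {suc (suc (suc i))} refl = joined-refl ⟦ F ⟧ _

    crossing : ∀ {t} → t ≡ e₀₁ ⊎ t ≡ e₀₂ ⊎ t ≡ e₁₂ → ∃₂ λ u v → Collinear t u v × u ∉ proj₁ Λ
    crossing = [ crossed zero zero , [ crossed zero (suc zero) , crossed (suc zero) (suc zero) ]′ ]′
      where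
      crossed : ∀ p i {t} → t ≡ point p (just i) ε → ∃₂ λ u v → Collinear t u v × u ∉ proj₁ Λ
      -- The second line passes through the zero-block points of `p` and `punchIn p i`; the first of
      -- these is not in `Λ`, whose partition has an empty zero block.
      crossed p i refl = _ , _ , zeroLine p i ,
        λ u∈ → M.κ≢nothing p (M.zero⇒κ (zeroAtom≼⁻ p (D.trans (∈⇒atom≼ Λ u∈) Λ≼)))

  -- The Dowling lattice of rank two

  module Rank2 {k} (G↔k : Inverse G.setoid (setoid (Fin k))) (iso : L 𝒞 ≅ DowlingLattice G 2) where

    open Coordinatised 𝒞 simple G 1 iso
    open Inverse G↔k using (to; from; to-cong; strictlyInverseˡ; strictlyInverseʳ)

    -- Names for the atoms of the lattice: one join of the two points for each group element, and
    -- one zero-block atom for each point.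
    Code : Set
    Code = Fin k ⊎ Fin 2

    pt : Code → Fin m
    pt (inj₁ i) = point zero (just zero) (from i)
    pt (inj₂ p) = point p nothing ε

    pt-injective : ∀ a b → pt a ≡ pt b → a ≡ b
    pt-injective (inj₁ i) (inj₁ j) eq
      with Atom.joined⇒label zero (just zero) (from j) (λ ()) (joinAtom≼⁻ zero zero (point≡⇒atom≼ eq))
    -- The second point has label `ε` in both atoms, so the translation `u` is trivial.
    ... | u , fromj≈ , ε≈ = cong inj₁ (trans (sym (strictlyInverseˡ i)) (trans (to-cong fromi≈fromj) (strictlyInverseˡ j)))
      where
      fromi≈fromj : from i ≈ from j
      fromi≈fromj = G.sym (G.trans fromj≈ (G.trans (G.∙-congʳ (G.sym (G.trans ε≈ (G.identityʳ u)))) (G.identityˡ _)))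
    pt-injective (inj₁ i) (inj₂ zero)       eq with () ← join≡⇒κ eq
    pt-injective (inj₁ i) (inj₂ (suc zero)) eq with () ← join≡⇒κ eq
    pt-injective (inj₂ zero)       (inj₁ j) eq with () ← zero≡⇒κ eq
    pt-injective (inj₂ (suc zero)) (inj₁ j) eq with () ← zero≡⇒κ eq
    pt-injective (inj₂ zero)       (inj₂ zero)       _  = refl
    pt-injective (inj₂ zero)       (inj₂ (suc zero)) eq with () ← zero≡⇒κ eq
    pt-injective (inj₂ (suc zero)) (inj₂ zero)       eq with () ← zero≡⇒κ eq
    pt-injective (inj₂ (suc zero)) (inj₂ (suc zero)) _  = refl

    -- By `coatomCases` the image of `⟨ x ⟩` lies above a coded atom, whose point then belongs to
    -- `⁅ x ⁆`.
    pt-surjective : ∀ x → ∃ λ a → pt a ≡ x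
    pt-surjective x with coatomCases ⟦ ⟨ x ⟩ ⟧ (size-point x)
    ... | inj₁ 0∈Z        = inj₂ zero , x∈⁅y⁆⇒x≡y x (atom≼⇒∈ ⟨ x ⟩ (zeroAtom≼⁺ zero 0∈Z))
    ... | inj₂ (inj₁ 1∈Z) = inj₂ (suc zero) , x∈⁅y⁆⇒x≡y x (atom≼⇒∈ ⟨ x ⟩ (zeroAtom≼⁺ (suc zero) 1∈Z))
    ... | inj₂ (inj₂ (g , joined)) = inj₁ (to g) , x∈⁅y⁆⇒x≡y x (atom≼⇒∈ ⟨ x ⟩
      (joinAtom≼⁺ zero zero (joined-congˡ ⟦ ⟨ x ⟩ ⟧ (G.sym (strictlyInverseʳ g)) joined)))

    m≡k+2 : m ≡ k + 2
    m≡k+2 = ≤-antisym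
      (injective⇒≤ {f = join k 2 ∘ code} λ {x} {y} eq →
        trans (sym (proj₂ (pt-surjective x))) (trans (cong pt
          (trans (sym (splitAt-join k 2 (code x))) (trans (cong (splitAt k) eq) (splitAt-join k 2 (code y)))))
          (proj₂ (pt-surjective y))))
      (injective⇒≤ {f = pt ∘ splitAt k} λ {a} {b} eq →
        trans (sym (join-splitAt k 2 a))
          (trans (cong (join k 2) (pt-injective (splitAt k a) (splitAt k b) eq)) (join-splitAt k 2 b)))
      where
      code : Fin m → Code
      code x = proj₁ (pt-surjective x)

    -- Were `w` missing, passing from `⟨ x ⟩` to `F` to `⊤` would drop the number of blocks twice,
    -- although `⟨ x ⟩` has at most one.
    full : ∀ {x y} → x ≢ y → (F : Flat) → x ∈ proj₁ F → y ∈ proj₁ F → ∀ w → w ∈ proj₁ F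
    full {x} {y} x≢y F x∈ y∈ w = decidable-stable (w ∈? proj₁ F) λ w∉ → 1+n≰n
      (≤-trans (s≤s (≤-trans (s≤s z≤n) (size-strict F (⊤ , ⊤-flat) ⊆⊤ ∈⊤ w∉)))
        (≤-trans (size-strict ⟨ x ⟩ F x⊆F y∈ (x≢y ∘ sym ∘ x∈⁅y⁆⇒x≡y x)) (size-point x)))
      where
      x⊆F : ⁅ x ⁆ ⊆ proj₁ F
      x⊆F z∈ = subst (_∈ proj₁ F) (sym (x∈⁅y⁆⇒x≡y x z∈)) x∈

    -- The line through the two zero-block points is the whole ground set, and the identity of `G`
    -- supplies a third point on it.
    length-ℰ : length ℰ ≡ 1
    length-ℰ = length-ℰ≡1 z₀z₁e e≢z₀ e≢z₁ λ w →
      ∈-span⁻ (full z₀≢z₁ (span P Q , span-flat sdr x∈ y∈) x∈ y∈ w)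
      where
      z₀≢z₁ : pt (inj₂ zero) ≢ pt (inj₂ (suc zero))
      z₀≢z₁ eq with () ← pt-injective (inj₂ zero) (inj₂ (suc zero)) eq

      e≢z₀ : pt (inj₁ (to ε)) ≢ pt (inj₂ zero)
      e≢z₀ eq with () ← pt-injective (inj₁ (to ε)) (inj₂ zero) eq

      e≢z₁ : pt (inj₁ (to ε)) ≢ pt (inj₂ (suc zero))
      e≢z₁ eq with () ← pt-injective (inj₁ (to ε)) (inj₂ (suc zero)) eq

      z₀z₁e : Collinear (pt (inj₂ zero)) (pt (inj₂ (suc zero))) (pt (inj₁ (to ε)))
      z₀z₁e = collinear z₀≢z₁ e≢z₀ e≢z₁ λ F x∈ y∈ → full z₀≢z₁ F x∈ y∈ _

      open Collinear z₀z₁e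

      x∈ : pt (inj₂ zero) ∈ span P Q
      x∈ = ∈-span⁺ coveredˣ

      y∈ : pt (inj₂ (suc zero)) ∈ span P Q
      y∈ = ∈-span⁺ coveredʸ

theorem4p15 : ∀ {m : ℕ} (𝒞 : Covering m) →
    let open Covering 𝒞 in
    (∀ {u v : Fin m} → u ≢ v →
    ¬ (meeting ⁅ u ⁆ ∼[ set ] meeting ⁅ v ⁆ × length (meeting ⁅ u ⁆) ≡ 1)) →
    ∀ {c ℓ} (G : Group c ℓ) {∣G∣ : ℕ} → Inverse (Group.setoid G) (setoid (Fin ∣G∣)) →
    (n : ℕ) → L 𝒞 ≅ DowlingLattice G n →
    ((n ≡ 0 ⊎ n ≡ 1) ⊎ n ≡ 2) ×
    (n ≡ 2 → m ≡ ∣G∣ + 2 × length ℰ ≡ 1)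
theorem4p15 𝒞 simple G G↔ 0 iso = inj₁ (inj₁ refl) , λ ()
theorem4p15 𝒞 simple G G↔ 1 iso = inj₁ (inj₂ refl) , λ ()
theorem4p15 𝒞 simple G G↔ 2 iso = inj₂ refl , λ _ → m≡k+2 , length-ℰ
  where open Rank2 𝒞 simple G G↔ iso
theorem4p15 𝒞 simple G G↔ (suc (suc (suc k))) iso = contradiction iso (rank≢3+k 𝒞 simple G k)
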